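{- Let $n\ge 1$, let $p\in\mathbb Z^n$ be a primitive vector and let $\Psi:\mathbb Z^n\to\mathbb Z$, $\Psi(z)=\min(0,p\cdot z)$. The sequence of $k$-huskings $(\Psi)_k$ stabilises eventually as $k\to\infty$, i.e. there exists $N>0$ such that $(\Psi)_k\equiv(\Psi)_N$ for all $k>N$. Moreover, $(\Psi)_N$ coincides with $\Psi$ outside a finite neighborhood of $D(\Psi)$, i.e. there is $C>0$ with $\{z:(\Psi)_N(z)\ne\Psi(z)\}\subset B_C(D(\Psi))$.
   Context: A vector $p\in\mathbb Z^n\setminus\{0\}$ is primitive if there are no integer $k>1$ and $p'\in\mathbb Z^n$ with $p=kp'$. For $z,z'\in\mathbb Z^n$, $z\sim z'$ means that their Euclidean distance is $1$. The discrete Laplacian is $\Delta F(z)=-2nF(z)+\sum_{z'\sim z}F(z')$; $F$ is superharmonic if $\Delta F\le 0$ everywhere. The deviation set of $F$ is $D(F)=\{z\in\mathbb Z^n:\Delta F(z)\ne 0\}$. For $S\subset\mathbb Z^n$ and $C>0$, $B_C(S)\subset\mathbb Z^n$ is the set of points whose Euclidean distance to $S$ is at most $C$. For a superharmonic $F:\mathbb Z^n\to\mathbb Z$ and $k\in\mathbb Z_{\ge0}$, $$\Theta_k(F)=\{G:\mathbb Z^n\to\mathbb Z \mid \Delta G\le 0,\ F-k\le G\le F,\ \exists C>0:\ \{F\ne G\}\subset B_C(D(F))\},$$ and the $k$-husking of $F$ is the function $(F)_k(z)=\min\{G(z): G\in\Theta_k(F)\}$. -}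

module Defs where

open import Data.Nat.Base as ℕ using (ℕ; zero; suc)
import Data.Nat.Properties as ℕₚ
open import Data.Integer.Base as ℤ
  using (ℤ; +_; -[1+_]; 0ℤ; 1ℤ; -1ℤ; ∣_∣; _+_; _-_; _*_; -_; _≤_; _<_; _⊓_)
open import Algebra.Bundles using (AbelianGroup)
import Data.Integer.Properties as ℤₚ
open import Algebra.Properties.Group (AbelianGroup.group ℤₚ.+-0-abelianGroup)
  using () renaming (∙-cancelˡ to +-cancelˡ)
open import Data.List.Base as List using (List)
open import Data.List.Membership.Propositional using (_∈_)
open import Data.List.Membership.Propositional.Properties using (∈-map⁺; ∈-map⁻)
open import Data.List.Relation.Unary.All as All using (All)
open import Data.List.Relation.Unary.Any using (here; there)
open import Data.List.Relation.Unary.AllPairs as AllPairs using ()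
open import Data.List.Relation.Unary.Unique.Propositional using (Unique)
import Data.List.Relation.Unary.Unique.Propositional.Properties as Uniqueₚ
open import Data.Product.Base using (_×_; _,_; ∃-syntax; Σ-syntax)
open import Data.Sum.Base using (_⊎_; inj₁; inj₂)
open import Data.Vec.Base as Vec using (Vec; []; _∷_; replicate; zipWith)
open import Data.Vec.Properties using (∷-injectiveˡ; ∷-injectiveʳ)
open import Level using (0ℓ)
open import Relation.Binary.PropositionalEquality
open import Relation.Nullary.Negation.Core using (¬_)
open import Relation.Unary using (Pred; _⊆_)

ℤ^ : ℕ → Set
ℤ^ n = Vec ℤ n

private variable
  n : ℕ

infix 4 _∼_
infixl 7 _·_

0ᵥ : ℤ^ n
0ᵥ = replicate _ 0ℤ

_·_ : ℤ^ n → ℤ^ n → ℤ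
p · z = Vec.foldr′ _+_ 0ℤ (zipWith _*_ p z)

Primitive : ℤ^ n → Set
Primitive {n} p =
  p ≢ 0ᵥ × ¬ (∃[ k ] 1ℤ < k × Σ[ p′ ∈ ℤ^ n ] p ≡ Vec.map (k *_) p′)

-- The square of the Euclidean distance.
distSq : ℤ^ n → ℤ^ n → ℕ
distSq z z′ = Vec.sum (zipWith (λ x y → ∣ x - y ∣ ℕ.^ 2) z z′)

_∼_ : ℤ^ n → ℤ^ n → Set
z ∼ z′ = distSq z z′ ≡ 1

-- Enumerates { z′ ∣ z ∼ z′ } without repetition: see ∈-neighbours⇒∼,
-- ∼⇒∈-neighbours and neighbours-unique below.
neighbours : ℤ^ n → List (ℤ^ n)
neighbours []      = List.[]
neighbours (x ∷ z) =
  (x + 1ℤ ∷ z) List.∷ (x - 1ℤ ∷ z) List.∷ List.map (x ∷_) (neighbours z)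

sumℤ : List ℤ → ℤ
sumℤ = List.foldr _+_ 0ℤ

Δ : (ℤ^ n → ℤ) → ℤ^ n → ℤ
Δ {n} F z = - (+ (2 ℕ.* n)) * F z + sumℤ (List.map F (neighbours z))

Superharmonic : (ℤ^ n → ℤ) → Set
Superharmonic F = ∀ z → Δ F z ≤ 0ℤ

D : (ℤ^ n → ℤ) → Pred (ℤ^ n) 0ℓ
D F z = Δ F z ≢ 0ℤ

｛_≢_｝ : (F G : ℤ^ n → ℤ) → Pred (ℤ^ n) 0ℓ
｛ F ≢ G ｝ z = F z ≢ G z

-- Distances to a nonempty subset of ℤⁿ are attained, so being at distance at
-- most C from S means being at distance at most C from some point of S. The
-- radius occurs only as "there is C > 0", so natural radii suffice.
B : ℕ → Pred (ℤ^ n) 0ℓ → Pred (ℤ^ n) 0ℓ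
B C S z = ∃[ s ] S s × distSq z s ℕ.≤ C ℕ.^ 2

record Θ (k : ℕ) (F G : ℤ^ n → ℤ) : Set where
  field
    superharmonic : Superharmonic G
    lower         : ∀ z → F z - + k ≤ G z
    upper         : ∀ z → G z ≤ F z
    near          : ∃[ C ] 0 ℕ.< C × ｛ F ≢ G ｝ ⊆ B C (D F)

IsMinimumOf : Pred ℤ 0ℓ → ℤ → Set
IsMinimumOf P m = P m × (∀ {v} → P v → m ≤ v)

-- H = (F)ₖ. A relation, since minima of arbitrary sets of integers
-- are not computable; it determines H pointwise by antisymmetry of ≤.
IsHusking : ℕ → (ℤ^ n → ℤ) → (ℤ^ n → ℤ) → Set
IsHusking k F H = ∀ z → IsMinimumOf (λ v → ∃[ G ] Θ k F G × G z ≡ v) (H z)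

Ψ : ℤ^ n → ℤ^ n → ℤ
Ψ p z = 0ℤ ⊓ (p · z)

private
  x-[x+i]≡-i : ∀ x i → x - (x + i) ≡ - i
  x-[x+i]≡-i x i = begin
    x - (x + i)      ≡⟨ cong (_+_ x) (ℤₚ.neg-distrib-+ x i) ⟩
    x + (- x + - i)  ≡⟨ ℤₚ.+-assoc x (- x) (- i) ⟨
    x - x + - i      ≡⟨ cong (_+ - i) (ℤₚ.+-inverseʳ x) ⟩
    0ℤ + - i         ≡⟨ ℤₚ.+-identityˡ (- i) ⟩
    - i              ∎
    where open ≡-Reasoning

  y≡x-[x-y] : ∀ x y → y ≡ x + - (x - y)
  y≡x-[x-y] x y = begin
    y                  ≡⟨ ℤₚ.+-identityˡ y ⟨
    0ℤ + y             ≡⟨ cong (_+ y) (ℤₚ.+-inverseʳ x) ⟨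
    x - x + y          ≡⟨ ℤₚ.+-assoc x (- x) y ⟩
    x + (- x + y)      ≡⟨ cong (λ w → x + (- x + w)) (ℤₚ.neg-involutive y) ⟨
    x + (- x + - - y)  ≡⟨ cong (_+_ x) (ℤₚ.neg-distrib-+ x (- y)) ⟨
    x + - (x - y)      ∎
    where open ≡-Reasoning

  x+i≢x : ∀ x i → i ≢ 0ℤ → x + i ≢ x
  x+i≢x x i i≢0 eq =
    i≢0 (+-cancelˡ x i 0ℤ (trans eq (sym (ℤₚ.+-identityʳ x))))

  distSq-refl : (z : ℤ^ n) → distSq z z ≡ 0
  distSq-refl []      = refl
  distSq-refl (x ∷ z) rewrite ℤₚ.+-inverseʳ x = distSq-refl z

  distSq≡0⇒≡ : (z z′ : ℤ^ n) → distSq z z′ ≡ 0 → z ≡ z′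
  distSq≡0⇒≡ []      []       _  = refl
  distSq≡0⇒≡ (x ∷ z) (y ∷ z′) eq = cong₂ _∷_
    (ℤₚ.i-j≡0⇒i≡j x y (ℤₚ.∣i∣≡0⇒i≡0
      (ℕₚ.m^n≡0⇒m≡0 ∣ x - y ∣ 2 (ℕₚ.m+n≡0⇒m≡0 (∣ x - y ∣ ℕ.^ 2) eq))))
    (distSq≡0⇒≡ z z′ (ℕₚ.m+n≡0⇒n≡0 (∣ x - y ∣ ℕ.^ 2) eq))

  square+m≡1 : ∀ i {m} → ∣ i ∣ ℕ.^ 2 ℕ.+ m ≡ 1 →
               (i ≡ 0ℤ × m ≡ 1) ⊎ (i ≡ 1ℤ × m ≡ 0) ⊎ (i ≡ -1ℤ × m ≡ 0)
  square+m≡1 (+ 0)             eq = inj₁ (refl , eq)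
  square+m≡1 (+ 1)             eq = inj₂ (inj₁ (refl , ℕₚ.suc-injective eq))
  square+m≡1 (+ suc (suc _))   ()
  square+m≡1 -[1+ 0 ]          eq = inj₂ (inj₂ (refl , ℕₚ.suc-injective eq))
  square+m≡1 -[1+ suc _ ]      ()

∈-neighbours⇒∼ : (z : ℤ^ n) {z′ : ℤ^ n} → z′ ∈ neighbours z → z ∼ z′
∈-neighbours⇒∼ (x ∷ z) (here refl)
  rewrite x-[x+i]≡-i x 1ℤ = cong suc (distSq-refl z)
∈-neighbours⇒∼ (x ∷ z) (there (here refl))
  rewrite x-[x+i]≡-i x -1ℤ = cong suc (distSq-refl z)
∈-neighbours⇒∼ (x ∷ z) (there (there z′∈)) with ∈-map⁻ (x ∷_) z′∈
... | w , w∈ , refl rewrite ℤₚ.+-inverseʳ x = ∈-neighbours⇒∼ z w∈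

∼⇒∈-neighbours : (z z′ : ℤ^ n) → z ∼ z′ → z′ ∈ neighbours z
∼⇒∈-neighbours []      []       ()
∼⇒∈-neighbours (x ∷ z) (y ∷ z′) z∼z′ with square+m≡1 (x - y) z∼z′
... | inj₁ (x-y≡0 , z∼z′₁)
  rewrite ℤₚ.i-j≡0⇒i≡j x y x-y≡0 =
  there (there (∈-map⁺ (y ∷_) (∼⇒∈-neighbours z z′ z∼z′₁)))
... | inj₂ (inj₁ (x-y≡1 , eq)) =
  there (here (cong₂ _∷_ (trans (y≡x-[x-y] x y) (cong (λ i → x + - i) x-y≡1))
                         (sym (distSq≡0⇒≡ z z′ eq))))
... | inj₂ (inj₂ (x-y≡-1 , eq)) =
  here (cong₂ _∷_ (trans (y≡x-[x-y] x y) (cong (λ i → x + - i) x-y≡-1))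
                  (sym (distSq≡0⇒≡ z z′ eq)))

neighbours-unique : (z : ℤ^ n) → Unique (neighbours z)
neighbours-unique []      = AllPairs.[]
neighbours-unique (x ∷ z) =
  ((λ eq → 1≢-1 (+-cancelˡ x 1ℤ -1ℤ (∷-injectiveˡ eq)))
    All.∷ All.tabulate (differs 1ℤ (λ ())))
  AllPairs.∷ All.tabulate (differs -1ℤ (λ ()))
  AllPairs.∷ Uniqueₚ.map⁺ ∷-injectiveʳ (neighbours-unique z)
  where
  1≢-1 : 1ℤ ≢ -1ℤ
  1≢-1 ()

  differs : ∀ i → i ≢ 0ℤ → ∀ {w} → w ∈ List.map (x ∷_) (neighbours z) →
            x + i ∷ z ≢ w
  differs i i≢0 w∈ eq with ∈-map⁻ (x ∷_) w∈
  ... | _ , _ , refl = x+i≢x x i i≢0 (∷-injectiveˡ eq)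

{-# OPTIONS --safe #-}
-- Minimising a competitor over the fibres of z ↦ p · z reduces everything to
-- functions h of t = p · z that are superharmonic for the operator L with steps
-- ± pᵢ, lie below ψ t = min (0 , t) and equal ψ far away. The flux of h is a
-- weighted sum of its slopes near t; it decreases from ∣ p ∣² to 0 as t grows.
-- A Harnack inequality at the point of steepest slope bounds the slopes by a
-- constant depending on p only. If the flux is constant on a long interval, then
-- the slope is harmonic there, and climbing to larger slopes ends, because slopes
-- are bounded integers, at a place where h is linear; so the flux is 0 or ∣ p ∣².
-- Hence the flux drops from ∣ p ∣² to 0 within a bounded distance, which by h ≤ ψ
-- happens near t = 0, and the maximum principle gives h = ψ outside an interval
-- depending on p only. Only finitely many h of bounded depth remain, their
-- depth is uniformly bounded, and the huskings are their pointwise minima.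
module Submission where

open import Data.Fin.Base as Fin using (Fin)
import Data.Fin.Properties as Finₚ
open import Data.Integer.Base as ℤ
  using (ℤ; +_; -[1+_]; 0ℤ; 1ℤ; -1ℤ; ∣_∣; _+_; _-_; _*_; -_; _⊓_)
import Data.Integer.Properties as ℤₚ
open import Data.Integer.Solver using (module +-*-Solver)
open import Data.List.Base as List using (List; length)
open import Data.List.Membership.Propositional using (_∈_)
import Data.List.Properties as Listₚ
open import Data.List.Relation.Unary.Any using (here; there)
open import Data.Nat.Base as ℕ using (ℕ; zero; suc; _≤_; _<_; z≤n; s≤s)
import Data.Nat.Divisibility as ∣
open import Data.Nat.GCD using (GCD; module GCD; module Bézout; mkGCD)
import Data.Nat.Properties as ℕₚ
open import Data.Product.Base using (_×_; _,_; proj₁; proj₂; ∃-syntax; Σ-syntax)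
open import Data.Sum.Base using (_⊎_; inj₁; inj₂)
open import Data.Vec.Base as Vec using ([]; _∷_)
import Data.Vec.Properties as Vecₚ
open import Function.Base using (_∘_)
open import Relation.Binary.PropositionalEquality
open import Relation.Nullary.Decidable.Core using (Dec; yes; no; decidable-stable)
open import Relation.Nullary.Negation.Core using (¬_; contradiction; DoubleNegation)
open import Relation.Unary using (_⊆_)
open import Defs

open +-*-Solver using (solve; con; _:=_; _:+_; _:-_; _:*_; :-_)

private variable
  A : Set
  n : ℕ

-- Inequalities and finite sums of integers

-- Linear arithmetic: an inequality follows from a sum of inequalities with the
-- same difference of sides.
≤-by-difference : ∀ {a b c d} → a ℤ.≤ b → d - c ≡ b - a → c ℤ.≤ d
≤-by-difference a≤b eq =
  ℤₚ.0≤i-j⇒j≤i (subst (0ℤ ℤ.≤_) (sym eq) (ℤₚ.i≤j⇒0≤j-i a≤b))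

sumℤ-mono : (f g : A → ℤ) (xs : List A) → (∀ {x} → x ∈ xs → f x ℤ.≤ g x) →
            sumℤ (List.map f xs) ℤ.≤ sumℤ (List.map g xs)
sumℤ-mono f g List.[]       f≤g = ℤₚ.≤-refl
sumℤ-mono f g (x List.∷ xs) f≤g =
  ℤₚ.+-mono-≤ (f≤g (here refl)) (sumℤ-mono f g xs (f≤g ∘ there))

sumℤ-0 : (xs : List A) → sumℤ (List.map (λ _ → 0ℤ) xs) ≡ 0ℤ
sumℤ-0 List.[]       = refl
sumℤ-0 (x List.∷ xs) = trans (ℤₚ.+-identityˡ _) (sumℤ-0 xs)

summand≤sumℤ : (f : A → ℤ) (xs : List A) → (∀ {x} → x ∈ xs → 0ℤ ℤ.≤ f x) →
               ∀ {x} → x ∈ xs → f x ℤ.≤ sumℤ (List.map f xs)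
summand≤sumℤ f (x List.∷ xs) f≥0 (here refl) = begin
  f x                                        ≡⟨ ℤₚ.+-identityʳ (f x) ⟨
  f x + 0ℤ                                   ≡⟨ cong (_+_ (f x)) (sumℤ-0 xs) ⟨
  f x + sumℤ (List.map (λ _ → 0ℤ) xs)
    ≤⟨ ℤₚ.+-monoʳ-≤ (f x) (sumℤ-mono (λ _ → 0ℤ) f xs (f≥0 ∘ there)) ⟩
  f x + sumℤ (List.map f xs)                 ∎
  where open ℤₚ.≤-Reasoning
summand≤sumℤ f (x List.∷ xs) f≥0 {y} (there y∈) = begin
  f y                         ≡⟨ ℤₚ.+-identityˡ (f y) ⟨
  0ℤ + f y                    ≤⟨ ℤₚ.+-mono-≤ (f≥0 (here refl))
                                             (summand≤sumℤ f xs (f≥0 ∘ there) y∈) ⟩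
  f x + sumℤ (List.map f xs)  ∎
  where open ℤₚ.≤-Reasoning

sumℤ-difference : (f : A → ℤ) (c : ℤ) (xs : List A) →
  sumℤ (List.map (λ x → f x - c) xs) ≡
  - (+ length xs) * c + sumℤ (List.map f xs)
sumℤ-difference f c List.[]       = sym (trans (ℤₚ.+-identityʳ _) (ℤₚ.*-zeroˡ c))
sumℤ-difference f c (x List.∷ xs) =
  trans (cong (_+_ (f x - c)) (sumℤ-difference f c xs))
        (solve 4 (λ a b l s → a :- b :+ (:- l :* b :+ s) :=
                              :- (con 1ℤ :+ l) :* b :+ (a :+ s))
               refl (f x) c (+ length xs) (sumℤ (List.map f xs)))

sumℤ-codifference : (f : A → ℤ) (c : ℤ) (xs : List A) →
  sumℤ (List.map (λ x → c - f x) xs) ≡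
  + length xs * c - sumℤ (List.map f xs)
sumℤ-codifference f c List.[]       = sym (trans (ℤₚ.+-identityʳ _) (ℤₚ.*-zeroˡ c))
sumℤ-codifference f c (x List.∷ xs) =
  trans (cong (_+_ (c - f x)) (sumℤ-codifference f c xs))
        (solve 4 (λ a b l s → b :- a :+ (l :* b :- s) :=
                              (con 1ℤ :+ l) :* b :- (a :+ s))
               refl (f x) c (+ length xs) (sumℤ (List.map f xs)))

-- The Laplacian of functions of `p · z`, and walks along its steps

-- The increments of z ↦ p · z along the edges of the lattice.
steps : ℤ^ n → List ℤ
steps []      = List.[]
steps (x ∷ p) = x List.∷ - x List.∷ steps p

-- The Laplacian of functions of p · z.
L : ℤ^ n → (ℤ → ℤ) → ℤ → ℤ
L p f t = sumℤ (List.map (λ σ → f (t + σ) - f t) (steps p))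

length-steps : (p : ℤ^ n) → length (steps p) ≡ 2 ℕ.* n
length-steps         []      = refl
length-steps {suc n} (x ∷ p) =
  trans (cong (suc ∘ suc) (length-steps p)) (sym (ℕₚ.*-suc 2 n))

-- `steps` follows the order of `neighbours`, so the sums agree term by term. The recursive call
-- absorbs the contribution `x * y` of the first coordinate into `f`.
sumℤ-neighbours : (p z : ℤ^ n) (f : ℤ → ℤ) →
  sumℤ (List.map (f ∘ (p ·_)) (neighbours z)) ≡
  sumℤ (List.map (λ σ → f (p · z + σ)) (steps p))
sumℤ-neighbours []      []      f = refl
sumℤ-neighbours (x ∷ p) (y ∷ z) f = cong₂ _+_
  (cong f (solve 3 (λ a b c → a :* (b :+ con 1ℤ) :+ c := a :* b :+ c :+ a)
                 refl x y (p · z)))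
  (cong₂ _+_
    (cong f (solve 3 (λ a b c → a :* (b :- con 1ℤ) :+ c := a :* b :+ c :- a)
                   refl x y (p · z)))
    rest)
  where
  open ≡-Reasoning
  rest : sumℤ (List.map (f ∘ ((x ∷ p) ·_)) (List.map (y ∷_) (neighbours z))) ≡
         sumℤ (List.map (λ σ → f ((x ∷ p) · (y ∷ z) + σ)) (steps p))
  rest = begin
    sumℤ (List.map (f ∘ ((x ∷ p) ·_)) (List.map (y ∷_) (neighbours z)))
      ≡⟨ cong sumℤ (Listₚ.map-∘ (neighbours z)) ⟨
    sumℤ (List.map (f ∘ _+_ (x * y) ∘ (p ·_)) (neighbours z))
      ≡⟨ sumℤ-neighbours p z (f ∘ _+_ (x * y)) ⟩
    sumℤ (List.map (λ σ → f (x * y + (p · z + σ))) (steps p))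
      ≡⟨ cong sumℤ (Listₚ.map-cong (λ σ → cong f (sym (ℤₚ.+-assoc (x * y) (p · z) σ)))
                                   (steps p)) ⟩
    sumℤ (List.map (λ σ → f ((x ∷ p) · (y ∷ z) + σ)) (steps p)) ∎

L-expand : (p : ℤ^ n) (f : ℤ → ℤ) (t : ℤ) →
  L p f t ≡ - (+ (2 ℕ.* n)) * f t + sumℤ (List.map (λ σ → f (t + σ)) (steps p))
L-expand p f t = trans (sumℤ-difference (λ σ → f (t + σ)) (f t) (steps p))
  (cong (λ l → - (+ l) * f t + sumℤ (List.map (λ σ → f (t + σ)) (steps p)))
        (length-steps p))

Δ-pullback : (p z : ℤ^ n) (f : ℤ → ℤ) → Δ (f ∘ (p ·_)) z ≡ L p f (p · z)
Δ-pullback {n} p z f = trans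
  (cong (_+_ (- (+ (2 ℕ.* n)) * f (p · z))) (sumℤ-neighbours p z f))
  (sym (L-expand p f (p · z)))

-- Used where `G` is minimal on its fibre: the central values agree and the neighbouring ones only
-- decrease, so the fibrewise minimum inherits superharmonicity.
L≤Δ : (p z : ℤ^ n) (g : ℤ → ℤ) (G : ℤ^ n → ℤ) → g (p · z) ≡ G z →
      (∀ w → g (p · w) ℤ.≤ G w) → L p g (p · z) ℤ.≤ Δ G z
L≤Δ {n} p z g G eq g≤G = begin
  L p g (p · z)             ≡⟨ Δ-pullback p z g ⟨
  Δ (g ∘ (p ·_)) z          ≡⟨ cong (λ v → - (+ (2 ℕ.* n)) * v + _) eq ⟩
  - (+ (2 ℕ.* n)) * G z + sumℤ (List.map (g ∘ (p ·_)) (neighbours z))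
    ≤⟨ ℤₚ.+-monoʳ-≤ (- (+ (2 ℕ.* n)) * G z)
         (sumℤ-mono _ G (neighbours z) (λ {w} _ → g≤G w)) ⟩
  Δ G z                     ∎
  where open ℤₚ.≤-Reasoning

-- The l¹ norm: for `p` it bounds every step, for `u` it counts the lattice steps from the origin to
-- `u`.
reach : ℤ^ n → ℕ
reach p = Vec.sum (Vec.map ∣_∣ p)

normSq : ℤ^ n → ℕ
normSq p = Vec.sum (Vec.map (λ x → ∣ x ∣ ℕ.* ∣ x ∣) p)

∣step∣≤reach : (p : ℤ^ n) {σ : ℤ} → σ ∈ steps p → ∣ σ ∣ ≤ reach p
∣step∣≤reach (x ∷ p) (here refl)         = ℕₚ.m≤m+n ∣ x ∣ (reach p)
∣step∣≤reach (x ∷ p) (there (here refl)) =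
  subst (_≤ reach (x ∷ p)) (sym (ℤₚ.∣-i∣≡∣i∣ x)) (ℕₚ.m≤m+n ∣ x ∣ (reach p))
∣step∣≤reach (x ∷ p) (there (there σ∈))  =
  ℕₚ.≤-trans (∣step∣≤reach p σ∈) (ℕₚ.m≤n+m (reach p) ∣ x ∣)

-step∈steps : (p : ℤ^ n) {σ : ℤ} → σ ∈ steps p → - σ ∈ steps p
-step∈steps (x ∷ p) (here refl)         = there (here refl)
-step∈steps (x ∷ p) (there (here refl)) = here (ℤₚ.neg-involutive x)
-step∈steps (x ∷ p) (there (there σ∈))  = there (there (-step∈steps p σ∈))

-- Q e s records what is known about s when it is reached after e steps.
walk : (p u : ℤ^ n) (Q : ℕ → ℤ → Set) →
       (∀ e s {σ} → σ ∈ steps p → Q e s → Q (suc e) (s + σ)) →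
       ∀ {e s} → Q e s → Q (reach u ℕ.+ e) (s + p · u)
walk []      []      Q step {e} {s} q = subst (Q e) (sym (ℤₚ.+-identityʳ s)) q
walk (x ∷ p) (y ∷ u) Q step {e} {s} q =
  subst₂ Q (reorder (reach u)) (ℤₚ.+-assoc s (x * y) (p · u))
    (walk p u Q (λ e s σ∈ → step e s (there (there σ∈))) (along y))
  where
  reorder : ∀ r → r ℕ.+ (∣ y ∣ ℕ.+ e) ≡ ∣ y ∣ ℕ.+ r ℕ.+ e
  reorder r = trans (sym (ℕₚ.+-assoc r ∣ y ∣ e)) (cong (ℕ._+ e) (ℕₚ.+-comm r ∣ y ∣))

  repeat : ∀ {σ} → σ ∈ steps (x ∷ p) → ∀ k → Q (k ℕ.+ e) (s + σ * + k)
  repeat {σ} σ∈ zero    =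
    subst (Q e) (sym (trans (cong (_+_ s) (ℤₚ.*-zeroʳ σ)) (ℤₚ.+-identityʳ s))) q
  repeat {σ} σ∈ (suc k) = subst (Q (suc k ℕ.+ e))
    (solve 3 (λ s σ k → s :+ σ :* k :+ σ := s :+ σ :* (con 1ℤ :+ k)) refl s σ (+ k))
    (step (k ℕ.+ e) (s + σ * + k) σ∈ (repeat σ∈ k))

  along : ∀ y → Q (∣ y ∣ ℕ.+ e) (s + x * y)
  along (+ k)      = repeat (here refl) k
  along (-[1+ k ]) = subst (λ i → Q (suc k ℕ.+ e) (s + i))
    (solve 2 (λ x k → :- x :* k := x :* :- k) refl x (+ suc k))
    (repeat (there (here refl)) (suc k))

-- Telescoping sums and the flux

Σ< : ℕ → (ℕ → ℤ) → ℤ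
Σ< zero    f = 0ℤ
Σ< (suc n) f = Σ< n f + f n

Σ<-cong : ∀ n {f g : ℕ → ℤ} → (∀ j → f j ≡ g j) → Σ< n f ≡ Σ< n g
Σ<-cong zero    eq = refl
Σ<-cong (suc n) eq = cong₂ _+_ (Σ<-cong n eq) (eq n)

Σ<-difference : ∀ n (f g : ℕ → ℤ) → Σ< n f - Σ< n g ≡ Σ< n (λ j → f j - g j)
Σ<-difference zero    f g = refl
Σ<-difference (suc n) f g = trans
  (solve 4 (λ a b c d → a :+ b :- (c :+ d) := a :- c :+ (b :- d))
         refl (Σ< n f) (f n) (Σ< n g) (g n))
  (cong (_+ (f n - g n)) (Σ<-difference n f g))

Σ<-telescope : ∀ n (f : ℕ → ℤ) → Σ< n (λ j → f (suc j) - f j) ≡ f n - f 0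
Σ<-telescope zero    f = sym (ℤₚ.+-inverseʳ (f 0))
Σ<-telescope (suc n) f = trans (cong (_+ (f (suc n) - f n)) (Σ<-telescope n f))
  (solve 3 (λ a b c → a :- b :+ (c :- a) := c :- b) refl (f n) (f 0) (f (suc n)))

Σ<-lower : ∀ n {c} {f : ℕ → ℤ} → (∀ j → j < n → c ℤ.≤ f j) → + n * c ℤ.≤ Σ< n f
Σ<-lower zero    {c}     c≤f = ℤₚ.≤-reflexive (ℤₚ.*-zeroˡ c)
Σ<-lower (suc n) {c} {f} c≤f = ≤-by-difference
  (ℤₚ.+-mono-≤ (Σ<-lower n (λ j j<n → c≤f j (ℕₚ.m<n⇒m<1+n j<n))) (c≤f n ℕₚ.≤-refl))
  (solve 4 (λ a b n c → a :+ b :- (con 1ℤ :+ n) :* c := a :+ b :- (n :* c :+ c))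
         refl (Σ< n f) (f n) (+ n) c)

Σ<-upper : ∀ n {c} {f : ℕ → ℤ} → (∀ j → j < n → f j ℤ.≤ c) → Σ< n f ℤ.≤ + n * c
Σ<-upper zero    {c}     f≤c = ℤₚ.≤-reflexive (sym (ℤₚ.*-zeroˡ c))
Σ<-upper (suc n) {c} {f} f≤c = ≤-by-difference
  (ℤₚ.+-mono-≤ (Σ<-upper n (λ j j<n → f≤c j (ℕₚ.m<n⇒m<1+n j<n))) (f≤c n ℕₚ.≤-refl))
  (solve 4 (λ a b n c → (con 1ℤ :+ n) :* c :- (a :+ b) := n :* c :+ c :- (a :+ b))
         refl (Σ< n f) (f n) (+ n) c)

δ : (ℤ → ℤ) → ℤ → ℤ
δ h t = h (t + 1ℤ) - h t

-- The inner sum telescopes to the increment of h from t + j - a to t + j; as j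
-- varies, these are the edges of length a that cross from below t to t or above.
flux₁ : ℕ → (ℤ → ℤ) → ℤ → ℤ
flux₁ a h t = Σ< a (λ j → Σ< a (λ l → δ h (t + (+ j + + l - + a))))

flux : ℤ^ n → (ℤ → ℤ) → ℤ → ℤ
flux []      h t = 0ℤ
flux (x ∷ p) h t = flux₁ ∣ x ∣ h t + flux p h t

-- Moving `t` by one turns the inner sum `I j` into `I (suc j)`, so the difference telescopes to
-- `I a - I 0`, the increments of `h` over the two edges of length `a` at `t`.
flux₁-step : ∀ a h t →
  flux₁ a h (t + 1ℤ) - flux₁ a h t ≡ (h (t + + a) - h t) + (h (t - + a) - h t)
flux₁-step a h t = begin
  flux₁ a h (t + 1ℤ) - flux₁ a h t
    ≡⟨ cong (_- flux₁ a h t) (Σ<-cong a (λ j → Σ<-cong a (λ l → cong (δ h)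
         (solve 4 (λ t j l a → t :+ con 1ℤ :+ (j :+ l :- a) :=
                               t :+ (con 1ℤ :+ j :+ l :- a))
                refl t (+ j) (+ l) (+ a))))) ⟩
  Σ< a (I ∘ suc) - Σ< a I          ≡⟨ Σ<-difference a (I ∘ suc) I ⟩
  Σ< a (λ j → I (suc j) - I j)     ≡⟨ Σ<-telescope a I ⟩
  I a - I 0                        ≡⟨ cong₂ _-_ (I≡ a) (I≡ 0) ⟩
  h (t + (+ a + + a - + a)) - h (t + (+ a + + 0 - + a)) -
  (h (t + (+ 0 + + a - + a)) - h (t + (+ 0 + + 0 - + a)))
    ≡⟨ cong₂ _-_
         (cong₂ (λ x y → h x - h y)
           (solve 2 (λ t a → t :+ (a :+ a :- a) := t :+ a) refl t (+ a))
           (solve 2 (λ t a → t :+ (a :+ con 0ℤ :- a) := t) refl t (+ a)))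
         (cong₂ (λ x y → h x - h y)
           (solve 2 (λ t a → t :+ (con 0ℤ :+ a :- a) := t) refl t (+ a))
           (solve 2 (λ t a → t :+ (con 0ℤ :+ con 0ℤ :- a) := t :- a) refl t (+ a))) ⟩
  h (t + + a) - h t - (h t - h (t - + a))
    ≡⟨ solve 3 (λ x y z → x :- y :- (y :- z) := (x :- y) :+ (z :- y))
         refl (h (t + + a)) (h t) (h (t - + a)) ⟩
  (h (t + + a) - h t) + (h (t - + a) - h t) ∎
  where
  open ≡-Reasoning
  I : ℕ → ℤ
  I j = Σ< a (λ l → δ h (t + (+ j + + l - + a)))

  I≡ : ∀ j → I j ≡ h (t + (+ j + + a - + a)) - h (t + (+ j + + 0 - + a))
  I≡ j = trans
    (Σ<-cong a (λ l → cong (λ x → h x - h (t + (+ j + + l - + a)))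
      (solve 4 (λ t j l a → t :+ (j :+ l :- a) :+ con 1ℤ :=
                            t :+ (j :+ (con 1ℤ :+ l) :- a))
             refl t (+ j) (+ l) (+ a))))
    (Σ<-telescope a (λ l → h (t + (+ j + + l - + a))))

-- A discrete divergence theorem. It makes the flux of a superharmonic `h` decrease, and stay
-- constant where `h` is harmonic.
flux-step : (p : ℤ^ n) (h : ℤ → ℤ) (t : ℤ) →
            flux p h (t + 1ℤ) - flux p h t ≡ L p h t
flux-step []      h t = refl
flux-step (x ∷ p) h t = begin
  (flux₁ ∣ x ∣ h (t + 1ℤ)) + flux p h (t + 1ℤ) - ((flux₁ ∣ x ∣ h t) + flux p h t)
    ≡⟨ solve 4 (λ a b c d → a :+ b :- (c :+ d) := (a :- c) :+ (b :- d))
         refl (flux₁ ∣ x ∣ h (t + 1ℤ)) (flux p h (t + 1ℤ)) (flux₁ ∣ x ∣ h t) (flux p h t) ⟩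
  ((flux₁ ∣ x ∣ h (t + 1ℤ)) - (flux₁ ∣ x ∣ h t)) + (flux p h (t + 1ℤ) - flux p h t)
    ≡⟨ cong₂ _+_ (trans (flux₁-step ∣ x ∣ h t) (abs x)) (flux-step p h t) ⟩
  (h (t + x) - h t) + (h (t - x) - h t) + L p h t
    ≡⟨ ℤₚ.+-assoc (h (t + x) - h t) _ _ ⟩
  L (x ∷ p) h t ∎
  where
  open ≡-Reasoning
  -- The flux sees only `∣ x ∣`; for negative `x` the steps `x` and `- x` change places.
  abs : ∀ x → (h (t + + ∣ x ∣) - h t) + (h (t - + ∣ x ∣) - h t) ≡
              (h (t + x) - h t) + (h (t - x) - h t)
  abs (+ a)    = refl
  abs -[1+ a ] = ℤₚ.+-comm (h (t + + suc a) - h t) (h (t + -[1+ a ]) - h t)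

private
  ∣j+l-a∣≤a : ∀ {j l a} → j < a → l < a → ∣ + j + + l - + a ∣ ≤ a
  ∣j+l-a∣≤a {j} {l} {a} j<a l<a =
    subst (_≤ a) (cong ∣_∣ (sym (ℤₚ.[+m]-[+n]≡m⊖n (j ℕ.+ l) a)))
      (go (ℕₚ.≤-total a (j ℕ.+ l)))
    where
    go : a ≤ j ℕ.+ l ⊎ j ℕ.+ l ≤ a → ∣ (j ℕ.+ l) ℤ.⊖ a ∣ ≤ a
    go (inj₁ a≤) rewrite ℤₚ.⊖-≥ a≤ =
      ℕₚ.m≤n+o⇒m∸n≤o (j ℕ.+ l) a (ℕₚ.+-mono-≤ (ℕₚ.<⇒≤ j<a) (ℕₚ.<⇒≤ l<a))
    go (inj₂ ≤a) rewrite ℤₚ.∣⊖∣-≤ ≤a = ℕₚ.m∸n≤m a (j ℕ.+ l)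

  normSq-* : ∀ x (p : ℤ^ n) c →
    + normSq (x ∷ p) * c ≡ + ∣ x ∣ * (+ ∣ x ∣ * c) + + normSq p * c
  normSq-* x p c = begin
    (+ (∣ x ∣ ℕ.* ∣ x ∣) + + normSq p) * c
      ≡⟨ cong (λ y → (y + + normSq p) * c) (ℤₚ.pos-* ∣ x ∣ ∣ x ∣) ⟩
    (+ ∣ x ∣ * + ∣ x ∣ + + normSq p) * c
      ≡⟨ solve 3 (λ a b c → (a :* a :+ b) :* c := a :* (a :* c) :+ b :* c)
           refl (+ ∣ x ∣) (+ normSq p) c ⟩
    + ∣ x ∣ * (+ ∣ x ∣ * c) + + normSq p * c ∎
    where open ≡-Reasoning

-- The flux is a sum of `normSq p` slopes: each coordinate contributes `∣ x ∣ * ∣ x ∣` of them, all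
-- within `reach p` of `t`.
flux-lower : (p : ℤ^ n) {h : ℤ → ℤ} {t c : ℤ} →
  (∀ o → ∣ o ∣ ≤ reach p → c ℤ.≤ δ h (t + o)) → + normSq p * c ℤ.≤ flux p h t
flux-lower []      {c = c} c≤δ = ℤₚ.≤-reflexive (ℤₚ.*-zeroˡ c)
flux-lower (x ∷ p) {c = c} c≤δ = subst (ℤ._≤ _) (sym (normSq-* x p c)) (ℤₚ.+-mono-≤
  (Σ<-lower ∣ x ∣ (λ j j< → Σ<-lower ∣ x ∣ (λ l l< →
    c≤δ _ (ℕₚ.≤-trans (∣j+l-a∣≤a j< l<) (ℕₚ.m≤m+n ∣ x ∣ (reach p))))))
  (flux-lower p (λ o o≤ → c≤δ o (ℕₚ.≤-trans o≤ (ℕₚ.m≤n+m (reach p) ∣ x ∣)))))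

flux-upper : (p : ℤ^ n) {h : ℤ → ℤ} {t c : ℤ} →
  (∀ o → ∣ o ∣ ≤ reach p → δ h (t + o) ℤ.≤ c) → flux p h t ℤ.≤ + normSq p * c
flux-upper []      {c = c} δ≤c = ℤₚ.≤-reflexive (sym (ℤₚ.*-zeroˡ c))
flux-upper (x ∷ p) {c = c} δ≤c = subst (_ ℤ.≤_) (sym (normSq-* x p c)) (ℤₚ.+-mono-≤
  (Σ<-upper ∣ x ∣ (λ j j< → Σ<-upper ∣ x ∣ (λ l l< →
    δ≤c _ (ℕₚ.≤-trans (∣j+l-a∣≤a j< l<) (ℕₚ.m≤m+n ∣ x ∣ (reach p))))))
  (flux-upper p (λ o o≤ → δ≤c o (ℕₚ.≤-trans o≤ (ℕₚ.m≤n+m (reach p) ∣ x ∣)))))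

flux-linear : (p : ℤ^ n) {h : ℤ → ℤ} {t c : ℤ} →
  (∀ o → ∣ o ∣ ≤ reach p → δ h (t + o) ≡ c) → flux p h t ≡ + normSq p * c
flux-linear p δ≡c = ℤₚ.≤-antisym
  (flux-upper p (λ o o≤ → ℤₚ.≤-reflexive (δ≡c o o≤)))
  (flux-lower p (λ o o≤ → ℤₚ.≤-reflexive (sym (δ≡c o o≤))))

-- Absolute values and maxima on intervals

∣i∣≤n⇒-n≤i : ∀ {i n} → ∣ i ∣ ≤ n → - + n ℤ.≤ i
∣i∣≤n⇒-n≤i {+ _}              _         = ℤₚ.neg-≤-pos
∣i∣≤n⇒-n≤i { -[1+ _ ]} {suc _} (s≤s i≤n) = ℤ.-≤- i≤n

∣i∣≤n⇒i≤n : ∀ {i n} → ∣ i ∣ ≤ n → i ℤ.≤ + n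
∣i∣≤n⇒i≤n {+ _}      i≤n = ℤ.+≤+ i≤n
∣i∣≤n⇒i≤n { -[1+ _ ]} _   = ℤ.-≤+

∣i∣≤1+n⇒ : ∀ {n} i → ∣ i ∣ ≤ suc n → ∣ i ∣ ≤ n ⊎ i ≡ + suc n ⊎ i ≡ -[1+ n ]
∣i∣≤1+n⇒ i i≤ with ℕₚ.m≤n⇒m<n∨m≡n i≤
∣i∣≤1+n⇒ i        i≤ | inj₁ (s≤s i≤n) = inj₁ i≤n
∣i∣≤1+n⇒ (+ _)    i≤ | inj₂ refl      = inj₂ (inj₁ refl)
∣i∣≤1+n⇒ -[1+ _ ] i≤ | inj₂ refl      = inj₂ (inj₂ refl)

∣i∣>n⇒ : ∀ {n} i → n < ∣ i ∣ → + n ℤ.< i ⊎ i ℤ.< - + n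
∣i∣>n⇒ (+ _)            n<i       = inj₁ (ℤ.+<+ n<i)
∣i∣>n⇒ {zero}  -[1+ _ ] n<i       = inj₂ ℤ.-<+
∣i∣>n⇒ {suc _} -[1+ _ ] (s≤s n<i) = inj₂ (ℤ.-<- n<i)

n<i⇒n<∣i∣ : ∀ {n i} → + n ℤ.< i → n < ∣ i ∣
n<i⇒n<∣i∣ (ℤ.+<+ n<i) = n<i

i<-n⇒n<∣i∣ : ∀ {n i} → i ℤ.< - + n → n < ∣ i ∣
i<-n⇒n<∣i∣ {zero}  { -[1+ _ ]} _           = s≤s z≤n
i<-n⇒n<∣i∣ {zero}  { + _ }     (ℤ.+<+ ())
i<-n⇒n<∣i∣ {suc _}             (ℤ.-<- n<i) = s≤s n<i

i<j⇒i+1≤j : ∀ {i j} → i ℤ.< j → i + 1ℤ ℤ.≤ j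
i<j⇒i+1≤j {i} i<j = subst (ℤ._≤ _) (ℤₚ.+-comm 1ℤ i) (ℤₚ.i<j⇒suc[i]≤j i<j)

i+1≤j⇒i<j : ∀ {i j} → i + 1ℤ ℤ.≤ j → i ℤ.< j
i+1≤j⇒i<j {i} le = ℤₚ.suc[i]≤j⇒i<j (subst (ℤ._≤ _) (ℤₚ.+-comm i 1ℤ) le)

i≤j⇒j≡i+n : ∀ {i j} → i ℤ.≤ j → ∃[ m ] j ≡ i + + m
i≤j⇒j≡i+n {i} {j} i≤j = ∣ j - i ∣ , (begin
  j                ≡⟨ solve 2 (λ i j → j := i :+ (j :- i)) refl i j ⟩
  i + (j - i)      ≡⟨ cong (_+_ i) (ℤₚ.0≤i⇒+∣i∣≡i (ℤₚ.i≤j⇒0≤j-i i≤j)) ⟨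
  i + + ∣ j - i ∣  ∎)
  where open ≡-Reasoning

max-on-ball : (f : ℤ → ℤ) (y : ℤ) (r : ℕ) →
  ∃[ m ] ∣ m ∣ ≤ r × (∀ o → ∣ o ∣ ≤ r → f (y + o) ℤ.≤ f (y + m))
max-on-ball f y zero    = 0ℤ , z≤n , λ o o≤ →
  ℤₚ.≤-reflexive (cong (f ∘ _+_ y) (ℤₚ.∣i∣≡0⇒i≡0 (ℕₚ.n≤0⇒n≡0 o≤)))
max-on-ball f y (suc r) =
  let m , m≤ , f≤m = max-on-ball f y r
      a , a≤ , m≤a , +≤a = larger m (+ suc r) (ℕₚ.m≤n⇒m≤1+n m≤) ℕₚ.≤-refl
      b , b≤ , a≤b , -≤b = larger a -[1+ r ] a≤ ℕₚ.≤-refl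
  in b , b≤ , λ o o≤ → bound (∣i∣≤1+n⇒ o o≤)
       (λ i≤ → ℤₚ.≤-trans (f≤m o i≤) (ℤₚ.≤-trans m≤a a≤b)) (ℤₚ.≤-trans +≤a a≤b) -≤b
  where
  larger : ∀ i j → ∣ i ∣ ≤ suc r → ∣ j ∣ ≤ suc r →
           ∃[ m ] ∣ m ∣ ≤ suc r × f (y + i) ℤ.≤ f (y + m) × f (y + j) ℤ.≤ f (y + m)
  larger i j i≤ j≤ with ℤₚ.≤-total (f (y + i)) (f (y + j))
  ... | inj₁ fi≤fj = j , j≤ , fi≤fj , ℤₚ.≤-refl
  ... | inj₂ fj≤fi = i , i≤ , ℤₚ.≤-refl , fj≤fi

  bound : ∀ {i v} → ∣ i ∣ ≤ r ⊎ i ≡ + suc r ⊎ i ≡ -[1+ r ] →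
          (∣ i ∣ ≤ r → f (y + i) ℤ.≤ v) → f (y + + suc r) ℤ.≤ v →
          f (y + -[1+ r ]) ℤ.≤ v → f (y + i) ℤ.≤ v
  bound (inj₁ i≤)          inside +≤ -≤ = inside i≤
  bound (inj₂ (inj₁ refl)) inside +≤ -≤ = +≤
  bound (inj₂ (inj₂ refl)) inside +≤ -≤ = -≤

-- Pairings and the size of steps

·-scale : (p u : ℤ^ n) (k : ℤ) → p · Vec.map (k *_) u ≡ k * (p · u)
·-scale []      []      k = sym (ℤₚ.*-zeroʳ k)
·-scale (x ∷ p) (y ∷ u) k = trans (cong (_+_ (x * (k * y))) (·-scale p u k))
  (solve 4 (λ x y k s → x :* (k :* y) :+ k :* s := k :* (x :* y :+ s))
         refl x y k (p · u))

reach-scale : (u : ℤ^ n) (k : ℤ) → reach (Vec.map (k *_) u) ≡ ∣ k ∣ ℕ.* reach u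
reach-scale []      k = sym (ℕₚ.*-zeroʳ ∣ k ∣)
reach-scale (x ∷ u) k = trans (cong₂ ℕ._+_ (ℤₚ.abs-* k x) (reach-scale u k))
  (sym (ℕₚ.*-distribˡ-+ ∣ k ∣ ∣ x ∣ (reach u)))

-- Some coordinate of `p` is nonzero, as the pairing would vanish otherwise; one of its two steps is
-- positive.
positive-step : (p u : ℤ^ n) → p · u ≢ 0ℤ → ∃[ a ] + suc a ∈ steps p
positive-step []              []      ≢0 = contradiction refl ≢0
positive-step (+ 0 ∷ p)       (y ∷ u) ≢0 =
  let a , a∈ = positive-step p u (λ eq → ≢0 (trans (ℤₚ.+-identityˡ (p · u)) eq))
  in a , there (there a∈)
positive-step (+ suc a ∷ p)   (y ∷ u) ≢0 = a , here refl
positive-step (-[1+ a ] ∷ p)  (y ∷ u) ≢0 = a , there (here refl)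

step²≤normSq : (p : ℤ^ n) {σ : ℤ} → σ ∈ steps p → ∣ σ ∣ ℕ.* ∣ σ ∣ ≤ normSq p
step²≤normSq (x ∷ p) (here refl)         = ℕₚ.m≤m+n (∣ x ∣ ℕ.* ∣ x ∣) (normSq p)
step²≤normSq (x ∷ p) (there (here refl)) =
  subst (λ k → k ℕ.* k ≤ normSq (x ∷ p)) (sym (ℤₚ.∣-i∣≡∣i∣ x))
        (ℕₚ.m≤m+n (∣ x ∣ ℕ.* ∣ x ∣) (normSq p))
step²≤normSq (x ∷ p) (there (there σ∈))  =
  ℕₚ.≤-trans (step²≤normSq p σ∈) (ℕₚ.m≤n+m (normSq p) (∣ x ∣ ℕ.* ∣ x ∣))

-- Slopes, reflection and profiles

L-δ : (p : ℤ^ n) (h : ℤ → ℤ) (t : ℤ) → L p (δ h) t ≡ L p h (t + 1ℤ) - L p h t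
L-δ []      h t = refl
L-δ (x ∷ p) h t = trans
  (cong₂ _+_ (difference x) (cong₂ _+_ (difference (- x)) (L-δ p h t)))
  (solve 6 (λ a b c d e f → (a :- b) :+ ((c :- d) :+ (e :- f)) :=
                            (a :+ (c :+ e)) :- (b :+ (d :+ f)))
         refl (h (t + 1ℤ + x) - h (t + 1ℤ)) (h (t + x) - h t)
              (h (t + 1ℤ - x) - h (t + 1ℤ)) (h (t - x) - h t)
              (L p h (t + 1ℤ)) (L p h t))
  where
  difference : ∀ σ → δ h (t + σ) - δ h t ≡
                     (h (t + 1ℤ + σ) - h (t + 1ℤ)) - (h (t + σ) - h t)
  difference σ = trans
    (cong (λ s → h s - h (t + σ) - δ h t)
          (solve 2 (λ t σ → t :+ σ :+ con 1ℤ := t :+ con 1ℤ :+ σ) refl t σ))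
    (solve 4 (λ a b c d → a :- b :- (c :- d) := a :- c :- (b :- d))
           refl (h (t + 1ℤ + σ)) (h (t + σ)) (h (t + 1ℤ)) (h t))

-- A symmetry that fixes `ψ` and exchanges the two ends of the line, so that statements about one
-- end carry over to the other.
reflect : (ℤ → ℤ) → ℤ → ℤ
reflect h t = h (- t) + t

L-reflect : (p : ℤ^ n) (h : ℤ → ℤ) (t : ℤ) → L p (reflect h) t ≡ L p h (- t)
L-reflect []      h t = refl
L-reflect (x ∷ p) h t = trans
  (cong (_+_ (reflect h (t + x) - reflect h t))
        (cong (_+_ (reflect h (t - x) - reflect h t)) (L-reflect p h t)))
  (trans
    (cong₂ (λ a b → h a + (t + x) - reflect h t + (h b + (t - x) - reflect h t + L p h (- t)))
      (solve 2 (λ t x → :- (t :+ x) := :- t :- x) refl t x)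
      (solve 2 (λ t x → :- (t :- x) := :- t :+ x) refl t x))
    (solve 6 (λ a b c l t x →
        a :+ (t :+ x) :- (b :+ t) :+ (c :+ (t :- x) :- (b :+ t) :+ l) :=
        c :- b :+ (a :- b :+ l))
      refl (h (- t - x)) (h (- t)) (h (- t + x)) (L p h (- t)) t x))

ψ : ℤ → ℤ
ψ t = 0ℤ ⊓ t

ψ-positive : ∀ {t} → 0ℤ ℤ.≤ t → ψ t ≡ 0ℤ
ψ-positive = ℤₚ.i≤j⇒i⊓j≡i

ψ-negative : ∀ {t} → t ℤ.≤ 0ℤ → ψ t ≡ t
ψ-negative = ℤₚ.i≥j⇒i⊓j≡j

reflect-ψ : ∀ t → reflect ψ t ≡ ψ t
reflect-ψ (+ 0)      = refl
reflect-ψ (+ suc n)  = ℤₚ.+-inverseˡ (+ suc n)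
reflect-ψ -[1+ n ]   = refl

-- The `radius` may vary with `h`; `uniform-support` later replaces it by a common one.
record Profile (p : ℤ^ n) (h : ℤ → ℤ) : Set where
  field
    superharmonic : ∀ t → L p h t ℤ.≤ 0ℤ
    upper         : ∀ t → h t ℤ.≤ ψ t
    radius        : ℕ
    outside       : ∀ t → radius < ∣ t ∣ → h t ≡ ψ t

reflect-profile : {p : ℤ^ n} {h : ℤ → ℤ} → Profile p h → Profile p (reflect h)
reflect-profile {p = p} {h} π = record
  { superharmonic = λ t → subst (ℤ._≤ 0ℤ) (sym (L-reflect p h t)) (superharmonic (- t))
  ; upper         = λ t → subst (reflect h t ℤ.≤_) (reflect-ψ t) (ℤₚ.+-monoˡ-≤ t (upper (- t)))
  ; radius        = radius
  ; outside       = λ t r<t → trans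
      (cong (_+ t) (outside (- t) (subst (radius <_) (sym (ℤₚ.∣-i∣≡∣i∣ t)) r<t)))
      (reflect-ψ t)
  }
  where open Profile π

-- The Harnack inequality and the bound on slopes

module Profiles {n : ℕ} (p u : ℤ^ n) (p·u≡1 : p · u ≡ 1ℤ) where

  -- As `p · u ≡ 1ℤ`, an offset `o` with `∣ o ∣ ≤ range` is a sum of `∣ o ∣ * reach u` steps, so
  -- fewer than `walkLength`; walks of length up to `walkLength` stay within `ball`. The `suc`
  -- yields `range ≤ ball`.
  degree mass range walkLength ball : ℕ
  degree     = length (steps p)
  mass       = normSq p
  range      = reach p
  walkLength = suc (range ℕ.* reach u)
  ball       = walkLength ℕ.* range

  unit : ∃[ a ] + suc a ∈ steps p
  unit = positive-step p u λ p·u≡0 → contradiction (trans (sym p·u≡1) p·u≡0) λ ()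

  0<mass : 0 < mass
  0<mass = ℕₚ.≤-trans (s≤s z≤n) (step²≤normSq p (proj₂ unit))

  -- The deficits `m - f (t + τ)` are nonnegative, so each is at most their sum, which is the
  -- right-hand side.
  neighbour-bound : ∀ {f t m σ} → (∀ {τ} → τ ∈ steps p → f (t + τ) ℤ.≤ m) →
    σ ∈ steps p → m - f (t + σ) ℤ.≤ + degree * (m - f t) - L p f t
  neighbour-bound {f} {t} {m} {σ} f≤m σ∈ = begin
    m - f (t + σ)
      ≤⟨ summand≤sumℤ (λ τ → m - f (t + τ)) (steps p) (λ τ∈ → ℤₚ.i≤j⇒0≤j-i (f≤m τ∈)) σ∈ ⟩
    sumℤ (List.map (λ τ → m - f (t + τ)) (steps p))
      ≡⟨ sumℤ-codifference (λ τ → f (t + τ)) m (steps p) ⟩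
    + degree * m - S
      ≡⟨ solve 4 (λ d m a s → d :* m :- s := d :* (m :- a) :- (:- d :* a :+ s))
               refl (+ degree) m (f t) S ⟩
    + degree * (m - f t) - (- (+ degree) * f t + S)
      ≡⟨ cong (_-_ (+ degree * (m - f t))) (sumℤ-difference (λ τ → f (t + τ)) (f t) (steps p)) ⟨
    + degree * (m - f t) - L p f t ∎
    where
    open ℤₚ.≤-Reasoning
    S : ℤ
    S = sumℤ (List.map (λ τ → f (t + τ)) (steps p))

  -- cost b e bounds the drop below a maximum after e steps if the Laplacian is at
  -- least - b; the recursion comes from neighbour-bound.
  cost : ℕ → ℕ → ℕ
  cost b zero    = 0
  cost b (suc e) = degree ℕ.* cost b e ℕ.+ (b ℕ.+ cost b e)

  cost-mono : ∀ b {e e′} → e ≤ e′ → cost b e ≤ cost b e′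
  cost-mono b e≤e′ = go (ℕₚ.≤⇒≤′ e≤e′)
    where
    go : ∀ {e e′} → e ℕ.≤′ e′ → cost b e ≤ cost b e′
    go (ℕ.≤′-reflexive refl)        = ℕₚ.≤-refl
    go (ℕ.≤′-step {n = e′} e≤e′) = ℕₚ.≤-trans (go e≤e′)
      (ℕₚ.≤-trans (ℕₚ.m≤n+m (cost b e′) b) (ℕₚ.m≤n+m _ (degree ℕ.* cost b e′)))

  cost-0 : ∀ e → cost 0 e ≡ 0
  cost-0 zero    = refl
  cost-0 (suc e) rewrite cost-0 e = trans (ℕₚ.+-identityʳ (degree ℕ.* 0)) (ℕₚ.*-zeroʳ degree)

  -- At a maximum, a lower bound for the Laplacian prevents f from dropping by
  -- more than a constant at the neighbours, and hence at every nearby point.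
  harnack : ∀ {f y} b →
    (∀ o → ∣ o ∣ ≤ ball → f (y + o) ℤ.≤ f y) →
    (∀ o → ∣ o ∣ ≤ ball → - + b ℤ.≤ L p f (y + o)) →
    ∀ o → ∣ o ∣ ≤ range → f y - + cost b walkLength ℤ.≤ f (y + o)
  harnack {f} {y} b f≤ L≥ o o≤ =
    let _ , _ , _ , bound = reached
    in ℤₚ.≤-trans
         (ℤₚ.+-monoʳ-≤ (f y) (ℤₚ.neg-mono-≤ (ℤ.+≤+ (cost-mono b e≤))))
         (subst (λ i → f y - + cost b e ℤ.≤ f (y + i)) p·w≡o bound)
    where
    -- `e ≤ walkLength` is a premise of the invariant because the hypotheses on `f` hold only while
    -- the walk stays in the ball.
    Q : ℕ → ℤ → Set
    Q e s = e ≤ walkLength →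
      ∃[ o ] s ≡ y + o × ∣ o ∣ ≤ e ℕ.* range × f y - + cost b e ℤ.≤ f s

    step : ∀ e s {σ} → σ ∈ steps p → Q e s → Q (suc e) (s + σ)
    step e s {σ} σ∈ q e<E with q (ℕₚ.<⇒≤ e<E)
    ... | o , refl , o≤ , bound =
      o + σ , ℤₚ.+-assoc y o σ , near σ∈ , ≤-by-difference bound′ eq
      where
      near : ∀ {τ} → τ ∈ steps p → ∣ o + τ ∣ ≤ suc e ℕ.* range
      near {τ} τ∈ = ℕₚ.≤-trans (ℤₚ.∣i+j∣≤∣i∣+∣j∣ o τ)
        (subst (_≤ suc e ℕ.* range) (ℕₚ.+-comm ∣ τ ∣ ∣ o ∣)
               (ℕₚ.+-mono-≤ (∣step∣≤reach p τ∈) o≤))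

      ≤max : ∀ {τ} → τ ∈ steps p → f (y + o + τ) ℤ.≤ f y
      ≤max {τ} τ∈ = subst (λ s → f s ℤ.≤ f y) (sym (ℤₚ.+-assoc y o τ))
        (f≤ (o + τ) (ℕₚ.≤-trans (near τ∈) (ℕₚ.*-monoˡ-≤ range e<E)))

      bound′ : f y - f (y + o + σ) + (+ degree * (f y - + cost b e) + (- + b + 0ℤ)) ℤ.≤
               (+ degree * (f y - f (y + o)) - L p f (y + o)) +
               (+ degree * f (y + o) + (L p f (y + o) + + cost b e))
      bound′ = ℤₚ.+-mono-≤ (neighbour-bound {f} {y + o} ≤max σ∈)
        (ℤₚ.+-mono-≤ (ℤₚ.*-monoˡ-≤-nonNeg (+ degree) bound)
          (ℤₚ.+-mono-≤ (L≥ o (ℕₚ.≤-trans o≤ (ℕₚ.*-monoˡ-≤ range (ℕₚ.<⇒≤ e<E))))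
                       (ℤ.+≤+ z≤n)))

      eq : f (y + o + σ) - (f y - + cost b (suc e)) ≡ _
      eq = trans
        (cong (λ c → f (y + o + σ) - (f y - c))
          (cong (_+ (+ b + + cost b e)) (ℤₚ.pos-* degree (cost b e))))
        (solve 7 (λ fσ fy fo l d b c →
            fσ :- (fy :- (d :* c :+ (b :+ c))) :=
            d :* (fy :- fo) :- l :+ (d :* fo :+ (l :+ c)) :-
            (fy :- fσ :+ (d :* (fy :- c) :+ (:- b :+ con 0ℤ))))
          refl (f (y + o + σ)) (f y) (f (y + o)) (L p f (y + o)) (+ degree) (+ b) (+ cost b e))

    w : ℤ^ n
    w = Vec.map (o *_) u

    p·w≡o : p · w ≡ o
    p·w≡o = trans (·-scale p u o) (trans (cong (o *_) p·u≡1) (ℤₚ.*-identityʳ o))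

    e : ℕ
    e = reach w ℕ.+ 0

    e≤ : e ≤ walkLength
    e≤ = subst (_≤ walkLength) (sym (trans (ℕₚ.+-identityʳ (reach w)) (reach-scale u o)))
               (ℕₚ.m≤n⇒m≤1+n (ℕₚ.*-monoˡ-≤ (reach u) o≤))

    reached : ∃[ o ] y + p · w ≡ y + o × ∣ o ∣ ≤ e ℕ.* range ×
                     f y - + cost b e ℤ.≤ f (y + p · w)
    reached = walk p w Q step
      (λ _ → 0ℤ , sym (ℤₚ.+-identityʳ y) , z≤n , ℤₚ.≤-reflexive (ℤₚ.+-identityʳ (f y))) e≤

  -- If the largest slope exceeded this, the Harnack inequality would make all slopes within `range`
  -- of its place at least 2, and the flux there at least twice `mass`.
  maxSlope : ℕ
  maxSlope = suc (cost mass walkLength)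

  module Flux {h : ℤ → ℤ} (π : Profile p h) where
    open Profile π

    Φ : ℤ → ℤ
    Φ = flux p h

    Φ-antitone : ∀ {s t} → s ℤ.≤ t → Φ t ℤ.≤ Φ s
    Φ-antitone {s} s≤t with i≤j⇒j≡i+n s≤t
    ... | m , refl = go m
      where
      go : ∀ m → Φ (s + + m) ℤ.≤ Φ s
      go zero    = ℤₚ.≤-reflexive (cong Φ (ℤₚ.+-identityʳ s))
      go (suc m) = ℤₚ.≤-trans
        (subst (λ i → Φ i ℤ.≤ Φ (s + + m))
          (solve 2 (λ s m → s :+ m :+ con 1ℤ := s :+ (con 1ℤ :+ m)) refl s (+ m))
          (ℤₚ.i-j≤0⇒i≤j (subst (ℤ._≤ 0ℤ) (sym (flux-step p h (s + + m)))
                               (superharmonic (s + + m)))))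
        (go m)

    δ-right : ∀ {t} → + radius ℤ.< t → δ h t ≡ 0ℤ
    δ-right {t} r<t = cong₂ _-_ (zero-at r<t+1) (zero-at r<t)
      where
      zero-at : ∀ {s} → + radius ℤ.< s → h s ≡ 0ℤ
      zero-at {s} r<s = trans (outside s (n<i⇒n<∣i∣ r<s))
        (ψ-positive (ℤₚ.<⇒≤ (ℤₚ.≤-<-trans (ℤ.+≤+ z≤n) r<s)))

      r<t+1 : + radius ℤ.< t + 1ℤ
      r<t+1 = ℤₚ.<-≤-trans r<t (ℤₚ.i≤i+j t 1ℤ)

    δ-left : ∀ {t} → t + 1ℤ ℤ.< - + radius → δ h t ≡ 1ℤ
    δ-left {t} t+1<-r = trans
      (cong₂ _-_ (id-at t+1<-r) (id-at (ℤₚ.≤-<-trans (ℤₚ.i≤i+j t 1ℤ) t+1<-r)))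
      (solve 1 (λ t → t :+ con 1ℤ :- t := con 1ℤ) refl t)
      where
      id-at : ∀ {s} → s ℤ.< - + radius → h s ≡ s
      id-at {s} s<-r = trans (outside s (i<-n⇒n<∣i∣ s<-r))
        (ψ-negative (ℤₚ.<⇒≤ (ℤₚ.<-≤-trans s<-r ℤₚ.neg-≤-pos)))

    private
      -- The flux at `t` uses slopes within `range` of `t`, each looking one point further; `far`
      -- keeps all these points outside `radius`.
      far : ℕ
      far = suc radius ℕ.+ suc range

    Φ-right : ∀ {t} → + far ℤ.≤ t → Φ t ≡ 0ℤ
    Φ-right {t} far≤t = trans (flux-linear p flat) (ℤₚ.*-zeroʳ (+ mass))
      where
      flat : ∀ o → ∣ o ∣ ≤ range → δ h (t + o) ≡ 0ℤ
      flat o o≤ = δ-right (i+1≤j⇒i<j (≤-by-difference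
        (ℤₚ.+-mono-≤ far≤t (ℤₚ.≤-trans (∣i∣≤n⇒-n≤i o≤) (ℤₚ.i≤i+j o 1ℤ)))
        (solve 4 (λ t o r m → t :+ o :- (r :+ con 1ℤ) :=
           t :+ (o :+ con 1ℤ) :- (con 1ℤ :+ r :+ (con 1ℤ :+ m) :+ :- m))
           refl t o (+ radius) (+ range))))

    Φ-left : ∀ {t} → t ℤ.≤ - + far → Φ t ≡ + mass
    Φ-left {t} t≤far = trans (flux-linear p steep) (ℤₚ.*-identityʳ (+ mass))
      where
      steep : ∀ o → ∣ o ∣ ≤ range → δ h (t + o) ≡ 1ℤ
      steep o o≤ = δ-left (i+1≤j⇒i<j (≤-by-difference
        (ℤₚ.+-mono-≤ t≤far (∣i∣≤n⇒i≤n o≤))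
        (solve 4 (λ t o r m → :- r :- (t :+ o :+ con 1ℤ :+ con 1ℤ) :=
           :- (con 1ℤ :+ r :+ (con 1ℤ :+ m)) :+ m :- (t :+ o))
           refl t o (+ radius) (+ range))))

    0≤Φ : ∀ t → 0ℤ ℤ.≤ Φ t
    0≤Φ t = subst (ℤ._≤ Φ t) (Φ-right (ℤₚ.i≤j⊔i t (+ far))) (Φ-antitone (ℤₚ.i≤i⊔j t (+ far)))

    Φ≤mass : ∀ t → Φ t ℤ.≤ + mass
    Φ≤mass t = subst (Φ t ℤ.≤_) (Φ-left (ℤₚ.i⊓j≤j t (- + far)))
                     (Φ-antitone (ℤₚ.i⊓j≤i t (- + far)))

    -mass≤L : ∀ t → - + mass ℤ.≤ L p h t
    -mass≤L t = ≤-by-difference (ℤₚ.+-mono-≤ (0≤Φ (t + 1ℤ)) (Φ≤mass t))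
      (trans (cong (_- (- + mass)) (sym (flux-step p h t)))
        (solve 3 (λ a b m → a :- b :- :- m := a :+ m :- (con 0ℤ :+ b))
               refl (Φ (t + 1ℤ)) (Φ t) (+ mass)))

    -- By `L-δ` this is a difference of two values of `L p h`, both between `- + mass` and 0. The
    -- Harnack inequality for the slope needs this bound.
    -mass≤Lδ : ∀ t → - + mass ℤ.≤ L p (δ h) t
    -mass≤Lδ t = ≤-by-difference (ℤₚ.+-mono-≤ (-mass≤L (t + 1ℤ)) (superharmonic t))
      (trans (cong (_- (- + mass)) (L-δ p h t))
        (solve 3 (λ a b m → a :- b :- :- m := a :+ con 0ℤ :- (:- m :+ b))
               refl (L p h (t + 1ℤ)) (L p h t) (+ mass)))

    δ≤1-outside : ∀ {t} → suc radius < ∣ t ∣ → δ h t ℤ.≤ 1ℤ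
    δ≤1-outside {t} r<t with ∣i∣>n⇒ t r<t
    ... | inj₁ r<t  = subst (ℤ._≤ 1ℤ)
      (sym (δ-right (ℤₚ.<-trans (ℤ.+<+ ℕₚ.≤-refl) r<t))) (ℤ.+≤+ z≤n)
    ... | inj₂ t<-r = ℤₚ.≤-reflexive (δ-left (i+1≤j⇒i<j (≤-by-difference
      (i<j⇒i+1≤j t<-r)
      (solve 2 (λ t r → :- r :- (t :+ con 1ℤ :+ con 1ℤ) :=
                        :- (con 1ℤ :+ r) :- (t :+ con 1ℤ)) refl t (+ radius)))))

    δ≤maxSlope : ∀ t → δ h t ℤ.≤ + maxSlope
    δ≤maxSlope t with δ h t ℤₚ.≤? + maxSlope
    ... | yes δ≤   = δ≤
    ... | no  δ≰ = contradiction (ℤₚ.≤-trans steep (Φ≤mass (0ℤ + m))) 2mass≰mass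
      where
      -- The ball contains `t`, so its maximal slope exceeds `maxSlope`; outside it slopes are at
      -- most 1, so that maximum is global.
      r : ℕ
      r = suc radius ℕ.+ ∣ t ∣

      top : ∃[ m ] ∣ m ∣ ≤ r × (∀ o → ∣ o ∣ ≤ r → δ h (0ℤ + o) ℤ.≤ δ h (0ℤ + m))
      top = max-on-ball (δ h) 0ℤ r

      m : ℤ
      m = proj₁ top

      large : + maxSlope ℤ.< δ h (0ℤ + m)
      large = ℤₚ.<-≤-trans (ℤₚ.≰⇒> δ≰)
        (subst (λ s → δ h s ℤ.≤ δ h (0ℤ + m)) (ℤₚ.+-identityˡ t)
               (proj₂ (proj₂ top) t (ℕₚ.m≤n+m ∣ t ∣ (suc radius))))

      maximal : ∀ s → δ h s ℤ.≤ δ h (0ℤ + m)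
      maximal s with ∣ s ∣ ℕₚ.≤? r
      ... | yes s≤r = subst (λ i → δ h i ℤ.≤ δ h (0ℤ + m)) (ℤₚ.+-identityˡ s)
                            (proj₂ (proj₂ top) s s≤r)
      ... | no  s≰r = ℤₚ.≤-trans
        (δ≤1-outside (ℕₚ.≤-<-trans (ℕₚ.m≤m+n (suc radius) ∣ t ∣) (ℕₚ.≰⇒> s≰r)))
        (ℤₚ.≤-trans (ℤ.+≤+ (s≤s z≤n)) (ℤₚ.<⇒≤ large))

      steep : + mass * + 2 ℤ.≤ Φ (0ℤ + m)
      steep = flux-lower p (λ o o≤ → ℤₚ.≤-trans
        (≤-by-difference (i<j⇒i+1≤j large)
          (solve 2 (λ a c → a :- c :- con (+ 2) := a :- (con 1ℤ :+ c :+ con 1ℤ))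
                 refl (δ h (0ℤ + m)) (+ cost mass walkLength)))
        (harnack {δ h} {0ℤ + m} mass (λ o _ → maximal (0ℤ + m + o))
                 (λ o _ → -mass≤Lδ (0ℤ + m + o)) o o≤))

      2mass≰mass : ¬ + mass * + 2 ℤ.≤ + mass
      2mass≰mass 2mass≤mass = ℕₚ.<⇒≱ 0<mass (ℤₚ.drop‿+≤+ (≤-by-difference 2mass≤mass
        (solve 1 (λ m → con 0ℤ :- m := m :- m :* con (+ 2)) refl (+ mass))))

  module _ {h : ℤ → ℤ} (π : Profile p h) where
    open Profile π
    open Flux π

    -- Reflection turns the slope `δ h t` into the slope `1ℤ - δ h t` at `- t - 1ℤ`, to which the
    -- upper bound applies.
    1-maxSlope≤δ : ∀ t → 1ℤ - + maxSlope ℤ.≤ δ h t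
    1-maxSlope≤δ t = ≤-by-difference (Flux.δ≤maxSlope (reflect-profile π) (- t - 1ℤ))
      (trans
        (solve 4 (λ a b k t → a :- b :- (con 1ℤ :- k) :=
                   k :- (b :+ (:- t :- con 1ℤ :+ con 1ℤ) :- (a :+ (:- t :- con 1ℤ))))
               refl (h (t + 1ℤ)) (h t) (+ maxSlope) t)
        (cong₂ (λ i j → + maxSlope - (h i + (- t - 1ℤ + 1ℤ) - (h j + (- t - 1ℤ))))
          (solve 1 (λ t → t := :- (:- t :- con 1ℤ :+ con 1ℤ)) refl t)
          (solve 1 (λ t → t :+ con 1ℤ := :- (:- t :- con 1ℤ)) refl t)))

-- Rigidity of the flux and uniform support

0≤q*s≤q⇒ : ∀ {q s} → 0 < q → 0ℤ ℤ.≤ + q * s → + q * s ℤ.≤ + q → s ≡ 0ℤ ⊎ s ≡ 1ℤ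
0≤q*s≤q⇒ {suc q} {s} _ 0≤qs qs≤q = go
  (ℤₚ.*-cancelˡ-≤-pos 0ℤ s (+ suc q)
    (subst (ℤ._≤ + suc q * s) (sym (ℤₚ.*-zeroʳ (+ suc q))) 0≤qs))
  (ℤₚ.*-cancelˡ-≤-pos s 1ℤ (+ suc q)
    (subst (+ suc q * s ℤ.≤_) (sym (ℤₚ.*-identityʳ (+ suc q))) qs≤q))
  where
  go : ∀ {s} → 0ℤ ℤ.≤ s → s ℤ.≤ 1ℤ → s ≡ 0ℤ ⊎ s ≡ 1ℤ
  go {+ 0} _ _ = inj₁ refl
  go {+ 1} _ _ = inj₂ refl
  go {+ suc (suc _)} _ (ℤ.+≤+ (s≤s ()))

-- While Φ lies strictly between its extreme values it drops on every interval of
-- length g, so q such intervals exhaust it.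
decrease-to-0 : ∀ {Φ : ℤ → ℤ} {g q : ℕ} →
  (∀ {s t} → s ℤ.≤ t → Φ t ℤ.≤ Φ s) → (∀ t → 0ℤ ℤ.≤ Φ t) →
  (∀ x → Φ (x + + g) ≡ Φ x → Φ x ≡ 0ℤ ⊎ Φ x ≡ + q) →
  ∀ {x} → Φ x ℤ.< + q → Φ (x + + (q ℕ.* g)) ≡ 0ℤ
decrease-to-0 {Φ} {g} {q} antitone 0≤Φ constant {x₀} Φ<q = conclude (descend q)
  where
  x : ℕ → ℤ
  x j = x₀ + + (j ℕ.* g)

  x-suc : ∀ j → x (suc j) ≡ x j + + g
  x-suc j = solve 3 (λ x g k → x :+ (g :+ k) := x :+ k :+ g) refl x₀ (+ g) (+ (j ℕ.* g))

  descend : ∀ j → Φ (x j) ≡ 0ℤ ⊎ Φ (x j) + + j ℤ.< + q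
  descend zero = inj₂ (subst (ℤ._< + q)
    (trans (cong Φ (sym (ℤₚ.+-identityʳ x₀))) (sym (ℤₚ.+-identityʳ (Φ (x 0))))) Φ<q)
  descend (suc j) rewrite x-suc j with descend j
  ... | inj₁ Φ≡0 = inj₁ (ℤₚ.≤-antisym
    (subst (Φ (x j + + g) ℤ.≤_) Φ≡0 (antitone (ℤₚ.i≤i+j (x j) (+ g)))) (0≤Φ (x j + + g)))
  ... | inj₂ Φ< with Φ (x j + + g) ℤₚ.≟ Φ (x j)
  ...   | no Φ≢ = inj₂ (ℤₚ.≤-<-trans
    (≤-by-difference (i<j⇒i+1≤j (ℤₚ.≤∧≢⇒< (antitone (ℤₚ.i≤i+j (x j) (+ g))) Φ≢))
      (solve 3 (λ a b j → b :+ j :- (a :+ (con 1ℤ :+ j)) := b :- (a :+ con 1ℤ))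
             refl (Φ (x j + + g)) (Φ (x j)) (+ j)))
    Φ<)
  ...   | yes Φ≡ with constant (x j) Φ≡
  ...     | inj₁ Φx≡0 = inj₁ (trans Φ≡ Φx≡0)
  ...     | inj₂ Φx≡q = contradiction
    (ℤₚ.≤-<-trans (ℤₚ.i≤i+j (Φ (x j)) (+ j)) Φ<) (ℤₚ.<-irrefl Φx≡q)

  conclude : Φ (x q) ≡ 0ℤ ⊎ Φ (x q) + + q ℤ.< + q → Φ (x q) ≡ 0ℤ
  conclude (inj₁ Φ≡0) = Φ≡0
  conclude (inj₂ Φ<)  = contradiction
    (ℤₚ.≤-<-trans (ℤₚ.+-monoˡ-≤ (+ q) (0≤Φ (x q))) Φ<) (ℤₚ.<-irrefl (ℤₚ.+-identityˡ (+ q)))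

module Rigidity {n : ℕ} (p u : ℤ^ n) (p·u≡1 : p · u ≡ 1ℤ) where
  open Profiles p u p·u≡1

  -- Slopes lie between `1ℤ - + maxSlope` and `+ maxSlope`, so a climb makes at most
  -- `maxSlope + maxSlope` moves of length at most `ball`; one more `ball` is for the final Harnack
  -- inequality. The outer `suc` in `halfGap` is there because `L p (δ h) t` involves
  -- `L p h (t + 1ℤ)`, that in `gap` because `L p h t` involves the flux at `t + 1ℤ`. The descent of
  -- the flux starts at 2 and takes `mass` intervals of length `gap`.
  halfGap gap supportRadius : ℕ
  halfGap       = suc (suc (maxSlope ℕ.+ maxSlope) ℕ.* ball)
  gap           = suc (halfGap ℕ.+ halfGap)
  supportRadius = 2 ℕ.+ mass ℕ.* gap

  module _ {h : ℤ → ℤ} (π : Profile p h) where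
    open Profile π
    open Flux π

    L≡0 : ∀ {t} → Φ (t + 1ℤ) ≡ Φ t → L p h t ≡ 0ℤ
    L≡0 {t} eq = trans (sym (flux-step p h t)) (ℤₚ.i≡j⇒i-j≡0 eq)

    -- Where δ h is harmonic, either it is maximal at y on a large ball, and then
    -- constant near y by the Harnack inequality, or there is a steeper place.
    climb : ∀ k y → + maxSlope ℤ.≤ δ h y + + k →
      (∀ o → ∣ o ∣ ≤ suc k ℕ.* ball → L p (δ h) (y + o) ≡ 0ℤ) →
      ∃[ o ] ∣ o ∣ ≤ k ℕ.* ball × (∃[ s ] Φ (y + o) ≡ + mass * s)
    climb k y steep harmonic with max-on-ball (δ h) y ball
    ... | m , m≤ , maximal with δ h (y + m) ℤₚ.≤? δ h y
    ... | yes ≤top = 0ℤ , z≤n , δ h y ,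
      trans (cong Φ (ℤₚ.+-identityʳ y)) (flux-linear p λ o o≤ →
        ℤₚ.≤-antisym
          (≤top′ o (ℕₚ.≤-trans o≤ range≤ball))
          (subst (ℤ._≤ δ h (y + o))
            (trans (cong (λ c → δ h y - + c) (cost-0 walkLength)) (ℤₚ.+-identityʳ (δ h y)))
            (harnack {δ h} {y} 0 ≤top′
              (λ o o≤ → ℤₚ.≤-reflexive (sym (harmonic o
                (ℕₚ.≤-trans o≤ (ℕₚ.m≤m+n ball (k ℕ.* ball))))))
              o o≤)))
      where
      ≤top′ : ∀ o → ∣ o ∣ ≤ ball → δ h (y + o) ℤ.≤ δ h y
      ≤top′ o o≤ = ℤₚ.≤-trans (maximal o o≤) ≤top

      range≤ball : range ≤ ball
      range≤ball = ℕₚ.m≤m+n range _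
    -- The number `k` bounds how far `δ h y` is below `maxSlope`; at 0 nothing can be steeper.
    climb zero    y steep harmonic | m , m≤ , maximal | no ≰top =
      contradiction (ℤₚ.≤-trans (δ≤maxSlope (y + m))
        (subst (_ ℤ.≤_) (ℤₚ.+-identityʳ (δ h y)) steep)) ≰top
    climb (suc k) y steep harmonic | m , m≤ , maximal | no ≰top =
      let o , o≤ , s , eq = climb k (y + m)
            (≤-by-difference (ℤₚ.+-mono-≤ steep (i<j⇒i+1≤j (ℤₚ.≰⇒> ≰top)))
              (solve 4 (λ a b k c → a :+ k :- c :=
                          b :+ (con 1ℤ :+ k) :+ a :- (c :+ (b :+ con 1ℤ)))
                     refl (δ h (y + m)) (δ h y) (+ k) (+ maxSlope)))
            (λ o o≤ → trans (cong (L p (δ h)) (ℤₚ.+-assoc y m o))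
                            (harmonic (m + o) (near o≤)))
      in m + o , near o≤ , s , trans (cong Φ (sym (ℤₚ.+-assoc y m o))) eq
      where
      near : ∀ {o j} → ∣ o ∣ ≤ j → ∣ m + o ∣ ≤ ball ℕ.+ j
      near {o} o≤ = ℕₚ.≤-trans (ℤₚ.∣i+j∣≤∣i∣+∣j∣ m o) (ℕₚ.+-mono-≤ m≤ o≤)

    module _ {x : ℤ} (eq : Φ (x + + gap) ≡ Φ x) where
      private
        y : ℤ
        y = x + + halfGap

        sandwich : ∀ {t} → x ℤ.≤ t → t ℤ.≤ x + + gap → Φ t ≡ Φ x
        sandwich {t} x≤t t≤ = ℤₚ.≤-antisym (Φ-antitone x≤t) (subst (ℤ._≤ Φ t) eq (Φ-antitone t≤))

        Φ≡ : ∀ o → ∣ o ∣ ≤ halfGap → Φ (y + o) ≡ Φ x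
        Φ≡ o o≤ = sandwich
          (≤-by-difference (∣i∣≤n⇒-n≤i {o} o≤)
            (solve 3 (λ x g o → x :+ g :+ o :- x := o :- :- g) refl x (+ halfGap) o))
          (≤-by-difference (ℤₚ.≤-trans (∣i∣≤n⇒i≤n {o} o≤) (ℤₚ.i≤j+i (+ halfGap) 1ℤ))
            (solve 3 (λ x g o → x :+ (con 1ℤ :+ (g :+ g)) :- (x :+ g :+ o) :=
                                con 1ℤ :+ g :- o) refl x (+ halfGap) o))

        Φ+1≡ : ∀ o → ∣ o ∣ ≤ halfGap → Φ (y + o + 1ℤ) ≡ Φ x
        Φ+1≡ o o≤ = sandwich
          (≤-by-difference (ℤₚ.≤-trans (∣i∣≤n⇒-n≤i {o} o≤) (ℤₚ.i≤i+j o 1ℤ))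
            (solve 3 (λ x g o → x :+ g :+ o :+ con 1ℤ :- x := o :+ con 1ℤ :- :- g)
                   refl x (+ halfGap) o))
          (≤-by-difference (∣i∣≤n⇒i≤n {o} o≤)
            (solve 3 (λ x g o → x :+ (con 1ℤ :+ (g :+ g)) :- (x :+ g :+ o :+ con 1ℤ) :=
                                g :- o) refl x (+ halfGap) o))

        Lh≡0 : ∀ o → ∣ o ∣ ≤ halfGap → L p h (y + o) ≡ 0ℤ
        Lh≡0 o o≤ = L≡0 (trans (Φ+1≡ o o≤) (sym (Φ≡ o o≤)))

        harmonic : ∀ o → ∣ o ∣ ≤ suc (maxSlope ℕ.+ maxSlope) ℕ.* ball →
                   L p (δ h) (y + o) ≡ 0ℤ
        harmonic o o≤ = trans (L-δ p h (y + o)) (cong₂ _-_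
          (trans (cong (L p h) (ℤₚ.+-assoc y o 1ℤ)) (Lh≡0 (o + 1ℤ)
            (ℕₚ.≤-trans (ℤₚ.∣i+j∣≤∣i∣+∣j∣ o 1ℤ)
              (subst (_≤ halfGap) (ℕₚ.+-comm 1 ∣ o ∣) (s≤s o≤)))))
          (Lh≡0 o (ℕₚ.m≤n⇒m≤1+n o≤)))

      -- Near the midpoint `climb` finds a place where the flux is `+ mass` times an integer slope
      -- `s`. As the flux lies between 0 and `+ mass`, this slope is 0 or 1.
      constant-flux : Φ x ≡ 0ℤ ⊎ Φ x ≡ + mass
      constant-flux =
        let o , o≤ , s , Φ≡mass*s = climb (maxSlope ℕ.+ maxSlope) y
              (≤-by-difference (ℤₚ.≤-trans (1-maxSlope≤δ π y) (ℤₚ.i≤i+j (δ h y) 1ℤ))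
                (solve 2 (λ d k → d :+ (k :+ k) :- k := d :+ con 1ℤ :- (con 1ℤ :- k))
                       refl (δ h y) (+ maxSlope)))
              harmonic
            Φx≡ = trans (sym (Φ≡ o (ℕₚ.≤-trans o≤ (ℕₚ.≤-trans
                    (ℕₚ.m≤n+m _ ball) (ℕₚ.n≤1+n _))))) Φ≡mass*s
        in extreme s Φx≡ (0≤q*s≤q⇒ 0<mass (subst (0ℤ ℤ.≤_) Φx≡ (0≤Φ x))
                                          (subst (ℤ._≤ + mass) Φx≡ (Φ≤mass x)))
        where
        extreme : ∀ s → Φ x ≡ + mass * s → s ≡ 0ℤ ⊎ s ≡ 1ℤ → Φ x ≡ 0ℤ ⊎ Φ x ≡ + mass
        extreme s eq (inj₁ refl) = inj₁ (trans eq (ℤₚ.*-zeroʳ (+ mass)))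
        extreme s eq (inj₂ refl) = inj₂ (trans eq (ℤₚ.*-identityʳ (+ mass)))

    h≤0 : ∀ t → h t ℤ.≤ 0ℤ
    h≤0 t = ℤₚ.≤-trans (upper t) (ℤₚ.i⊓j≤i 0ℤ t)

    -- Maximum principle: h ≤ 0, so zeros of h spread from a harmonic point to
    -- its neighbours.
    vanish : ∀ {x} → (∀ s → x ℤ.≤ s → L p h s ≡ 0ℤ) → ∀ s → x ℤ.≤ s → h s ≡ 0ℤ
    vanish {x} harmonic s x≤s = go (suc radius ℕ.+ ∣ s ∣) s x≤s
      (≤-by-difference (∣i∣≤n⇒-n≤i {s} ℕₚ.≤-refl)
        (solve 3 (λ s r a → s :+ (con 1ℤ :+ r :+ a) :- (con 1ℤ :+ r) := s :- :- a)
               refl s (+ radius) (+ ∣ s ∣)))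
      where
      a : ℕ
      a = proj₁ unit

      -- The induction runs leftwards from beyond `radius`: a zero at the harmonic point
      -- `t + + suc a` forces one at `t`, and `j` bounds the distance from `t` to the outside.
      go : ∀ j t → x ℤ.≤ t → + suc radius ℤ.≤ t + + j → h t ≡ 0ℤ
      go zero    t x≤t r<t = trans
        (outside t (n<i⇒n<∣i∣ (ℤₚ.<-≤-trans (ℤ.+<+ ℕₚ.≤-refl) r<t′)))
        (ψ-positive (ℤₚ.≤-trans (ℤ.+≤+ z≤n) r<t′))
        where
        r<t′ : + suc radius ℤ.≤ t
        r<t′ = subst (+ suc radius ℤ.≤_) (ℤₚ.+-identityʳ t) r<t
      go (suc j) t x≤t r<t = ℤₚ.≤-antisym (h≤0 t)
        (ℤₚ.i-j≤0⇒i≤j (subst₂ ℤ._≤_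
          (cong (λ s → 0ℤ - h s) (solve 2 (λ t a → t :+ a :- a := t) refl t (+ suc a)))
          bound≡0
          (neighbour-bound {h} {t + + suc a} (λ {τ} _ → h≤0 (t + + suc a + τ))
            (-step∈steps p (proj₂ unit)))))
        where
        x≤t+a : x ℤ.≤ t + + suc a
        x≤t+a = ℤₚ.≤-trans x≤t (ℤₚ.i≤i+j t (+ suc a))

        h[t+a]≡0 : h (t + + suc a) ≡ 0ℤ
        h[t+a]≡0 = go j (t + + suc a) x≤t+a
          (ℤₚ.≤-trans r<t (≤-by-difference {0ℤ} {+ a} (ℤ.+≤+ z≤n)
            (solve 3 (λ t a j → t :+ (con 1ℤ :+ a) :+ j :- (t :+ (con 1ℤ :+ j)) := a :- con 0ℤ)
                   refl t (+ a) (+ j))))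

        bound≡0 : + degree * (0ℤ - h (t + + suc a)) - L p h (t + + suc a) ≡ 0ℤ
        bound≡0 = trans
          (cong₂ (λ v w → + degree * (0ℤ - v) - w) h[t+a]≡0 (harmonic (t + + suc a) x≤t+a))
          (trans (ℤₚ.+-identityʳ _) (ℤₚ.*-zeroʳ (+ degree)))

  module _ {h : ℤ → ℤ} (π : Profile p h) where
    open Profile π
    open Flux π

    -- Full flux at 2 persists to the left, so `h` is harmonic up to 1, and `vanish` for the
    -- reflected profile gives `h 1ℤ ≡ 1ℤ`, above `ψ 1ℤ`.
    Φ2≢mass : Φ (+ 2) ≢ + mass
    Φ2≢mass eq =
      contradiction (ℤₚ.≤-trans (ℤₚ.≤-reflexive (sym h1≡1)) (upper 1ℤ)) λ { (ℤ.+≤+ ()) }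
      where
      full : ∀ {t} → t ℤ.≤ + 2 → Φ t ≡ + mass
      full {t} t≤2 = ℤₚ.≤-antisym (Φ≤mass t) (subst (ℤ._≤ Φ t) eq (Φ-antitone t≤2))

      harmonic : ∀ s → -1ℤ ℤ.≤ s → L p (reflect h) s ≡ 0ℤ
      harmonic s -1≤s = trans (L-reflect p h s) (L≡0 π (trans
        (full (ℤₚ.+-monoˡ-≤ 1ℤ -s≤1))
        (sym (full (ℤₚ.≤-trans -s≤1 (ℤ.+≤+ (s≤s z≤n)))))))
        where
        -s≤1 : - s ℤ.≤ 1ℤ
        -s≤1 = ℤₚ.neg-mono-≤ -1≤s

      h1≡1 : h 1ℤ ≡ 1ℤ
      h1≡1 = ℤₚ.i-j≡0⇒i≡j (h 1ℤ) 1ℤ (vanish (reflect-profile π) harmonic -1ℤ ℤₚ.≤-refl)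

    Φ-supportRadius : Φ (+ supportRadius) ≡ 0ℤ
    Φ-supportRadius = decrease-to-0 {Φ} Φ-antitone 0≤Φ
      (λ x Φ≡ → constant-flux π {x} Φ≡) {+ 2} (ℤₚ.≤∧≢⇒< (Φ≤mass (+ 2)) Φ2≢mass)

    vanish-right : ∀ t → + supportRadius ℤ.≤ t → h t ≡ 0ℤ
    vanish-right = vanish π λ s R≤s →
      L≡0 π (trans (Φ≡0 (ℤₚ.≤-trans R≤s (ℤₚ.i≤i+j s 1ℤ))) (sym (Φ≡0 R≤s)))
      where
      Φ≡0 : ∀ {t} → + supportRadius ℤ.≤ t → Φ t ≡ 0ℤ
      Φ≡0 {t} R≤t = ℤₚ.≤-antisym (subst (Φ t ℤ.≤_) Φ-supportRadius (Φ-antitone R≤t)) (0≤Φ t)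

  uniform-support : ∀ {h} → Profile p h → ∀ t → supportRadius ≤ ∣ t ∣ → h t ≡ ψ t
  uniform-support π (+ m)        R≤ = vanish-right π (+ m) (ℤ.+≤+ R≤)
  uniform-support {h} π -[1+ m ] R≤ = ℤₚ.i-j≡0⇒i≡j (h -[1+ m ]) -[1+ m ]
    (vanish-right (reflect-profile π) (+ suc m) (ℤ.+≤+ R≤))

  -- Inside the support `h` is at most twice `supportRadius` away from the zero at `supportRadius`,
  -- and slopes are at most `maxSlope`.
  depth : ℕ
  depth = maxSlope ℕ.* (supportRadius ℕ.+ supportRadius)

  module _ {h : ℤ → ℤ} (π : Profile p h) where
    private
      fall : ∀ m t → h (t + + m) ℤ.≤ h t + + (maxSlope ℕ.* m)
      fall zero    t = ℤₚ.≤-trans (ℤₚ.≤-reflexive (cong h (ℤₚ.+-identityʳ t)))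
                                  (ℤₚ.i≤i+j (h t) _)
      fall (suc m) t = ≤-by-difference
        (ℤₚ.+-mono-≤ (fall m (t + 1ℤ)) (Flux.δ≤maxSlope π t))
        (trans
          (cong₂ (λ s k → h t + + k - h s)
            (solve 2 (λ t m → t :+ (con 1ℤ :+ m) := t :+ con 1ℤ :+ m) refl t (+ m))
            (ℕₚ.*-suc maxSlope m))
          (solve 5 (λ a b c k l → a :+ (k :+ l) :- c := b :+ l :+ k :- (c :+ (b :- a)))
            refl (h t) (h (t + 1ℤ)) (h (t + 1ℤ + + m)) (+ maxSlope) (+ (maxSlope ℕ.* m))))

    uniform-depth : ∀ t → ψ t - + depth ℤ.≤ h t
    uniform-depth t with supportRadius ℕₚ.≤? ∣ t ∣
    ... | yes R≤t = ℤₚ.≤-trans (ℤₚ.i-j≤i (ψ t) (+ depth))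
                               (ℤₚ.≤-reflexive (sym (uniform-support π t R≤t)))
    ... | no  R≰t with i≤j⇒j≡i+n (∣i∣≤n⇒i≤n {t} (ℕₚ.<⇒≤ (ℕₚ.≰⇒> R≰t)))
    ... | m , R≡t+m = ≤-by-difference
      (ℤₚ.+-mono-≤ (ℤₚ.+-mono-≤ (ℤₚ.i⊓j≤i 0ℤ t) (ℤ.+≤+ (ℕₚ.*-monoʳ-≤ maxSlope m≤2R)))
        (subst (ℤ._≤ h t + + (maxSlope ℕ.* m))
               (trans (cong h (sym R≡t+m)) (vanish-right π (+ supportRadius) ℤₚ.≤-refl))
               (fall m t)))
      (solve 4 (λ v a k d → a :- (v :- d) := con 0ℤ :+ d :+ (a :+ k) :- (v :+ k :+ con 0ℤ))
             refl (ψ t) (h t) (+ (maxSlope ℕ.* m)) (+ depth))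
      where
      m≤2R : m ≤ supportRadius ℕ.+ supportRadius
      m≤2R = ℤₚ.drop‿+≤+ (≤-by-difference
        (∣i∣≤n⇒-n≤i {t} (ℕₚ.<⇒≤ (ℕₚ.≰⇒> R≰t)))
        (trans (cong (λ r → + supportRadius + r - + m) R≡t+m)
          (solve 3 (λ r t m → r :+ (t :+ m) :- m := t :- :- r) refl (+ supportRadius) t (+ m))))

-- Greatest common divisors and dual vectors

multiple : ∀ {d} x → d ∣.∣ ∣ x ∣ → ∃[ y ] x ≡ + d * y
multiple {d} (+ _)    (∣.divides q eq) = + q ,
  trans (cong +_ (trans eq (ℕₚ.*-comm q d))) (ℤₚ.pos-* d q)
multiple {d} -[1+ _ ] (∣.divides q eq) = - + q ,
  trans (cong (-_ ∘ +_) (trans eq (ℕₚ.*-comm q d)))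
        (trans (cong -_ (ℤₚ.pos-* d q)) (ℤₚ.neg-distribʳ-* (+ d) (+ q)))

bézout : ∀ {d} x m → GCD ∣ x ∣ m d → ∃[ a ] ∃[ b ] x * a + + m * b ≡ + d
bézout {d} x m g = signed x (unsigned (Bézout.identity g))
  where
  cast : ∀ a i b j → d ℕ.+ a ℕ.* i ≡ b ℕ.* j → + i * - + a + + j * + b ≡ + d
  cast a i b j eq = trans
    (solve 4 (λ a i b j → i :* :- a :+ j :* b := b :* j :- a :* i) refl (+ a) (+ i) (+ b) (+ j))
    (trans (cong (_- + a * + i) (begin
      + b * + j         ≡⟨ ℤₚ.pos-* b j ⟨
      + (b ℕ.* j)       ≡⟨ cong +_ eq ⟨
      + d + + (a ℕ.* i) ≡⟨ cong (_+_ (+ d)) (ℤₚ.pos-* a i) ⟩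
      + d + + a * + i   ∎))
      (solve 2 (λ d x → d :+ x :- x := d) refl (+ d) (+ a * + i)))
    where open ≡-Reasoning

  unsigned : Bézout.Identity d ∣ x ∣ m → ∃[ a ] ∃[ b ] + ∣ x ∣ * a + + m * b ≡ + d
  unsigned (Bézout.+- a b eq) = + a , - + b ,
    trans (ℤₚ.+-comm (+ ∣ x ∣ * + a) (+ m * - + b)) (cast b m a ∣ x ∣ eq)
  unsigned (Bézout.-+ a b eq) = - + a , + b , cast a ∣ x ∣ b m eq

  signed : ∀ x → (∃[ a ] ∃[ b ] + ∣ x ∣ * a + + m * b ≡ + d) →
           ∃[ a ] ∃[ b ] x * a + + m * b ≡ + d
  signed (+ _)    id            = id
  signed -[1+ i ] (a , b , eq) = - a , b , trans
    (solve 4 (λ i a m b → :- i :* :- a :+ m :* b := i :* a :+ m :* b)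
           refl (+ suc i) a (+ m) b) eq

-- Here `d` is the greatest common divisor of the entries, built up coordinate by coordinate with
-- Bézout coefficients.
content : (p : ℤ^ n) →
  ∃[ d ] (∃[ p′ ] p ≡ Vec.map (+ d *_) p′) × (∃[ u ] p · u ≡ + d)
content []      = 0 , ([] , refl) , ([] , refl)
content (x ∷ p) =
  let m , (p′ , p≡) , (u , p·u≡) = content p
      d , g                      = mkGCD ∣ x ∣ m
      x′ , x≡                    = multiple x (GCD.gcd∣m g)
      m′ , m≡                    = multiple (+ m) (GCD.gcd∣n g)
      a , b , eq                 = bézout x m g
  in d ,
     (x′ ∷ Vec.map (m′ *_) p′ , cong₂ _∷_ x≡
       (trans p≡ (trans
         (Vecₚ.map-cong (λ y → trans (cong (_* y) m≡) (ℤₚ.*-assoc (+ d) m′ y)) p′)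
         (Vecₚ.map-∘ (+ d *_) (m′ *_) p′)))) ,
     (a ∷ Vec.map (b *_) u ,
       trans (cong (_+_ (x * a)) (trans (·-scale p u b)
               (trans (cong (b *_) p·u≡) (ℤₚ.*-comm b (+ m))))) eq)

map-0* : (p : ℤ^ n) → Vec.map (0ℤ *_) p ≡ 0ᵥ
map-0* []      = refl
map-0* (x ∷ p) = cong₂ _∷_ (ℤₚ.*-zeroˡ x) (map-0* p)

primitive⇒dual : {p : ℤ^ n} → Primitive p → ∃[ u ] p · u ≡ 1ℤ
primitive⇒dual {p = p} (p≢0 , indivisible) with content p
... | 0           , (p′ , p≡) , _   = contradiction (trans p≡ (map-0* p′)) p≢0
... | 1           , _         , dual = dual
... | suc (suc d) , (p′ , p≡) , _   =
  contradiction (+ suc (suc d) , ℤ.+<+ (s≤s (s≤s z≤n)) , p′ , p≡) indivisible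

-- Minima of superharmonic functions and admissible profiles

L-mono : (p : ℤ^ n) (f g : ℤ → ℤ) {t : ℤ} → f t ≡ g t → (∀ s → f s ℤ.≤ g s) →
         L p f t ℤ.≤ L p g t
L-mono p f g {t} eq f≤g = sumℤ-mono _ _ (steps p) λ {σ} _ →
  ℤₚ.+-mono-≤ (f≤g (t + σ)) (ℤₚ.≤-reflexive (cong -_ eq))

L-cong : (p : ℤ^ n) (f g : ℤ → ℤ) (t : ℤ) → (∀ o → ∣ o ∣ ≤ reach p → f (t + o) ≡ g (t + o)) →
         L p f t ≡ L p g t
L-cong p f g t f≡g = ℤₚ.≤-antisym
  (sumℤ-mono _ _ (steps p) λ σ∈ → ℤₚ.≤-reflexive (terms σ∈))
  (sumℤ-mono _ _ (steps p) λ σ∈ → ℤₚ.≤-reflexive (sym (terms σ∈)))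
  where
  terms : ∀ {σ} → σ ∈ steps p → f (t + σ) - f t ≡ g (t + σ) - g t
  terms {σ} σ∈ = cong₂ _-_ (f≡g σ (∣step∣≤reach p σ∈))
    (subst (λ s → f s ≡ g s) (ℤₚ.+-identityʳ t) (f≡g 0ℤ z≤n))

L-const : (p : ℤ^ n) (c t : ℤ) → L p (λ _ → c) t ≡ 0ℤ
L-const []      c t = refl
L-const (x ∷ p) c t = cong₂ _+_ (ℤₚ.+-inverseʳ c) (cong₂ _+_ (ℤₚ.+-inverseʳ c) (L-const p c t))

L-id : (p : ℤ^ n) (t : ℤ) → L p (λ s → s) t ≡ 0ℤ
L-id []      t = refl
L-id (x ∷ p) t = trans
  (cong (λ l → t + x - t + (t - x - t + l)) (L-id p t))
  (solve 2 (λ t x → t :+ x :- t :+ (t :- x :- t :+ con 0ℤ) := con 0ℤ) refl t x)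

-- At each point the minimum agrees with the smaller function and is nowhere above it, so its
-- Laplacian there is at most that of the smaller one.
L-⊓ : (p : ℤ^ n) (f g : ℤ → ℤ) → (∀ t → L p f t ℤ.≤ 0ℤ) → (∀ t → L p g t ℤ.≤ 0ℤ) →
      ∀ t → L p (λ s → f s ⊓ g s) t ℤ.≤ 0ℤ
L-⊓ p f g Lf≤0 Lg≤0 t with ℤₚ.≤-total (f t) (g t)
... | inj₁ f≤g = ℤₚ.≤-trans
  (L-mono p _ f (ℤₚ.i≤j⇒i⊓j≡i f≤g) (λ s → ℤₚ.i⊓j≤i (f s) (g s))) (Lf≤0 t)
... | inj₂ g≤f = ℤₚ.≤-trans
  (L-mono p _ g (ℤₚ.i≥j⇒i⊓j≡j g≤f) (λ s → ℤₚ.i⊓j≤j (f s) (g s))) (Lg≤0 t)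

Lψ≤0 : (p : ℤ^ n) → ∀ t → L p ψ t ℤ.≤ 0ℤ
Lψ≤0 p = L-⊓ p (λ _ → 0ℤ) (λ t → t)
  (λ t → ℤₚ.≤-reflexive (L-const p 0ℤ t))
  (λ t → ℤₚ.≤-reflexive (L-id p t))

-- Beyond `reach p` all points `t + σ` lie on one side of 0, where `ψ` is linear.
Lψ≢0⇒∣t∣≤reach : (p : ℤ^ n) {t : ℤ} → L p ψ t ≢ 0ℤ → ∣ t ∣ ≤ reach p
Lψ≢0⇒∣t∣≤reach p {t} Lψ≢0 with ∣ t ∣ ℕₚ.≤? reach p
... | yes t≤ = t≤
... | no  t≰ with ∣i∣>n⇒ t (ℕₚ.≰⇒> t≰)
... | inj₁ r<t = contradiction
  (trans (L-cong p ψ (λ _ → 0ℤ) t (λ o o≤ → ψ-positive {t + o} (≤-by-difference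
           (ℤₚ.+-mono-≤ (ℤₚ.<⇒≤ r<t) (∣i∣≤n⇒-n≤i {o} o≤))
           (solve 3 (λ t o r → t :+ o :- con 0ℤ := t :+ o :- (r :+ :- r))
                  refl t o (+ reach p)))))
         (L-const p 0ℤ t)) Lψ≢0
... | inj₂ t<-r = contradiction
  (trans (L-cong p ψ (λ s → s) t (λ o o≤ → ψ-negative {t + o} (≤-by-difference
           (ℤₚ.+-mono-≤ (ℤₚ.<⇒≤ t<-r) (∣i∣≤n⇒i≤n {o} o≤))
           (solve 3 (λ t o r → con 0ℤ :- (t :+ o) := :- r :+ r :- (t :+ o))
                  refl t o (+ reach p)))))
         (L-id p t)) Lψ≢0

-- The one-dimensional counterpart of `Θ k (Ψ p)`; `admissible⇒Θ` and `fibre-minimum` relate the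
-- two.
record Admissible (p : ℤ^ n) (k : ℕ) (h : ℤ → ℤ) : Set where
  field
    profile : Profile p h
    lower   : ∀ t → ψ t - + k ℤ.≤ h t
  open Profile profile public

ψ-admissible : (p : ℤ^ n) (k : ℕ) → Admissible p k ψ
ψ-admissible p k = record
  { profile = record { superharmonic = Lψ≤0 p ; upper = λ _ → ℤₚ.≤-refl
                     ; radius = 0 ; outside = λ _ _ → refl }
  ; lower   = λ t → ℤₚ.i-j≤i (ψ t) (+ k)
  }

⊓-admissible : {p : ℤ^ n} {k : ℕ} {f g : ℤ → ℤ} →
  Admissible p k f → Admissible p k g → Admissible p k (λ t → f t ⊓ g t)
⊓-admissible {p = p} {f = f} {g} α β = record
  { profile = record
    { superharmonic = L-⊓ p f g α.superharmonic β.superharmonic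
    ; upper   = λ t → ℤₚ.≤-trans (ℤₚ.i⊓j≤i (f t) (g t)) (α.upper t)
    ; radius  = α.radius ℕ.⊔ β.radius
    ; outside = λ t r< → trans
        (cong₂ _⊓_ (α.outside t (ℕₚ.≤-<-trans (ℕₚ.m≤m⊔n α.radius β.radius) r<))
                   (β.outside t (ℕₚ.≤-<-trans (ℕₚ.m≤n⊔m α.radius β.radius) r<)))
        (ℤₚ.⊓-idem (ψ t))
    }
  ; lower = λ t → ℤₚ.⊓-glb (α.lower t) (β.lower t)
  }
  where
  module α = Admissible α
  module β = Admissible β

-- Enumeration and the least admissible profile

-- Admissible functions with a common support form a finite set, encoded by
-- their depths below ψ; it is closed under pointwise minima.
module Enumeration (p : ℤ^ n) (R k : ℕ)
  (supported : ∀ {h} → Profile p h → ∀ t → R ≤ ∣ t ∣ → h t ≡ ψ t) where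

  index : ∀ t → ∣ t ∣ < R → Fin (R ℕ.+ R)
  index t t<R = Fin.fromℕ< {∣ t + + R ∣}
    (ℕₚ.≤-<-trans (ℤₚ.∣i+j∣≤∣i∣+∣j∣ t (+ R)) (ℕₚ.+-monoˡ-< R t<R))

  place : Fin (R ℕ.+ R) → ℤ
  place i = + Fin.toℕ i - + R

  place-index : ∀ t t<R → place (index t t<R) ≡ t
  place-index t t<R = begin
    + Fin.toℕ (index t t<R) - + R  ≡⟨ cong (λ i → + i - + R) (Finₚ.toℕ-fromℕ< _) ⟩
    + ∣ t + + R ∣ - + R            ≡⟨ cong (_- + R) (ℤₚ.0≤i⇒+∣i∣≡i 0≤t+R) ⟩
    t + + R - + R                  ≡⟨ solve 2 (λ t r → t :+ r :- r := t) refl t (+ R) ⟩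
    t                              ∎
    where
    open ≡-Reasoning
    0≤t+R : 0ℤ ℤ.≤ t + + R
    0≤t+R = ≤-by-difference (∣i∣≤n⇒-n≤i {t} (ℕₚ.<⇒≤ t<R))
      (solve 2 (λ t r → t :+ r :- con 0ℤ := t :- :- r) refl t (+ R))

  decode : (Fin (R ℕ.+ R) → Fin (suc k)) → ℤ → ℤ
  decode d t with ∣ t ∣ ℕₚ.<? R
  ... | yes t<R = ψ t - + Fin.toℕ (d (index t t<R))
  ... | no  _   = ψ t

  module _ {h : ℤ → ℤ} (α : Admissible p k h) where
    open Admissible α

    0≤depth : ∀ t → 0ℤ ℤ.≤ ψ t - h t
    0≤depth t = ℤₚ.i≤j⇒0≤j-i (upper t)

    encode : Fin (R ℕ.+ R) → Fin (suc k)
    encode i = Fin.fromℕ< {∣ ψ t - h t ∣} (s≤s (ℤₚ.drop‿+≤+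
      (subst (ℤ._≤ + k) (sym (ℤₚ.0≤i⇒+∣i∣≡i (0≤depth t)))
        (≤-by-difference (lower t)
          (solve 3 (λ a b k → k :- (a :- b) := b :- (a :- k)) refl (ψ t) (h t) (+ k))))))
      where
      t : ℤ
      t = place i

    decode-encode : ∀ t → decode encode t ≡ h t
    decode-encode t with ∣ t ∣ ℕₚ.<? R
    ... | no  t≮R = sym (supported profile t (ℕₚ.≮⇒≥ t≮R))
    ... | yes t<R = begin
      ψ t - + Fin.toℕ (encode (index t t<R))
        ≡⟨ cong (λ i → ψ t - + i) (Finₚ.toℕ-fromℕ< _) ⟩
      ψ t - + ∣ ψ (place (index t t<R)) - h (place (index t t<R)) ∣
        ≡⟨ cong (λ s → ψ t - + ∣ ψ s - h s ∣) (place-index t t<R) ⟩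
      ψ t - + ∣ ψ t - h t ∣
        ≡⟨ cong (_-_ (ψ t)) (ℤₚ.0≤i⇒+∣i∣≡i (0≤depth t)) ⟩
      ψ t - (ψ t - h t)
        ≡⟨ solve 2 (λ a b → a :- (a :- b) := b) refl (ψ t) (h t) ⟩
      h t ∎
      where open ≡-Reasoning

  decode-upper : ∀ d t → decode d t ℤ.≤ ψ t
  decode-upper d t with ∣ t ∣ ℕₚ.<? R
  ... | yes t<R = ℤₚ.i-j≤i (ψ t) (+ Fin.toℕ (d (index t t<R)))
  ... | no  _   = ℤₚ.≤-refl

  decode-lower : ∀ d t → ψ t - + k ℤ.≤ decode d t
  decode-lower d t with ∣ t ∣ ℕₚ.<? R
  ... | yes t<R = ℤₚ.+-monoʳ-≤ (ψ t) (ℤₚ.neg-mono-≤ (ℤ.+≤+ (Finₚ.toℕ≤pred[n] (d (index t t<R)))))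
  ... | no  _   = ℤₚ.i-j≤i (ψ t) (+ k)

  decode-outside : ∀ d t → R < ∣ t ∣ → decode d t ≡ ψ t
  decode-outside d t R<t with ∣ t ∣ ℕₚ.<? R
  ... | yes t<R = contradiction t<R (ℕₚ.<⇒≯ R<t)
  ... | no  _   = refl

  -- For `∣ t ∣` above `R`, `decode d` touches `ψ` from below, so its Laplacian is at most that of
  -- `ψ`; only a finite test remains.
  decode-admissible : ∀ d → (∀ t → ∣ t ∣ ≤ R → L p (decode d) t ℤ.≤ 0ℤ) →
                      Admissible p k (decode d)
  decode-admissible d L≤0 = record
    { profile = record
      { superharmonic = λ t → superharmonic t (∣ t ∣ ℕₚ.≤? R)
      ; upper         = decode-upper d
      ; radius        = R
      ; outside       = decode-outside d
      }
    ; lower = decode-lower d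
    }
    where
    superharmonic : ∀ t → Dec (∣ t ∣ ≤ R) → L p (decode d) t ℤ.≤ 0ℤ
    superharmonic t (yes t≤R) = L≤0 t t≤R
    superharmonic t (no  t≰R) = ℤₚ.≤-trans
      (L-mono p (decode d) ψ (decode-outside d t (ℕₚ.≰⇒> t≰R)) (decode-upper d)) (Lψ≤0 p t)

  -- The largest Laplacian on a ball decides whether `decode d` is superharmonic. Codes that fail
  -- represent no admissible function and may be sent to `ψ`.
  select : ∀ d → ∃[ h ] Admissible p k h ×
    (∀ {g} → Admissible p k g → (∀ t → decode d t ≡ g t) → ∀ t → h t ℤ.≤ g t)
  select d with max-on-ball (L p (decode d)) 0ℤ R
  ... | m , _ , maximal with L p (decode d) (0ℤ + m) ℤₚ.≤? 0ℤ
  ... | yes ≤0 = decode d ,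
    decode-admissible d (λ t t≤R → ℤₚ.≤-trans
      (subst (λ s → L p (decode d) s ℤ.≤ L p (decode d) (0ℤ + m)) (ℤₚ.+-identityˡ t)
             (maximal t t≤R)) ≤0) ,
    λ _ eq t → ℤₚ.≤-reflexive (eq t)
  ... | no ≰0  = ψ , ψ-admissible p k , λ {g} γ eq → contradiction
    (subst (ℤ._≤ 0ℤ) (sym (L-cong p (decode d) g (0ℤ + m) (λ o _ → eq (0ℤ + m + o))))
           (Admissible.superharmonic γ (0ℤ + m)))
    ≰0

  minimum : ∀ m (f : Fin m → ∃[ h ] Admissible p k h) →
            ∃[ h ] Admissible p k h × (∀ i t → h t ℤ.≤ proj₁ (f i) t)
  -- Starting from `ψ` is harmless, since every profile lies below it.
  minimum zero    f = ψ , ψ-admissible p k , λ ()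
  minimum (suc m) f with f Fin.zero in eq | minimum m (f ∘ Fin.suc)
  ... | g , γ | h , α , h≤ = (λ t → g t ⊓ h t) , ⊓-admissible γ α , λ where
    Fin.zero    t → subst (λ w → g t ⊓ h t ℤ.≤ proj₁ w t) (sym eq) (ℤₚ.i⊓j≤i (g t) (h t))
    (Fin.suc i) t → ℤₚ.≤-trans (ℤₚ.i⊓j≤j (g t) (h t)) (h≤ i t)

  least : ∃[ h ] Admissible p k h × (∀ {g} → Admissible p k g → ∀ t → h t ℤ.≤ g t)
  least =
    let f = λ (i : Fin (suc k ℕ.^ (R ℕ.+ R))) → select (Fin.finToFun i)
        h , α , h≤ = minimum (suc k ℕ.^ (R ℕ.+ R)) (λ i → proj₁ (f i) , proj₁ (proj₂ (f i)))
    in h , α , λ {g} γ t →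
      let i = Fin.funToFin (encode γ)
      in ℤₚ.≤-trans (h≤ i t) (proj₂ (proj₂ (f i)) γ
           (λ s → trans (decode-cong (Finₚ.finToFun-funToFin (encode γ)) s) (decode-encode γ s)) t)
    where
    decode-cong : ∀ {d d′} → (∀ i → d i ≡ d′ i) → ∀ t → decode d t ≡ decode d′ t
    decode-cong eq t with ∣ t ∣ ℕₚ.<? R
    ... | yes t<R = cong (λ i → ψ t - + Fin.toℕ i) (eq (index t t<R))
    ... | no  _   = refl

-- Euclidean distance and the pairing

·-sub : (p z w : ℤ^ n) → p · Vec.zipWith _-_ z w ≡ p · z - p · w
·-sub []      []      []      = refl
·-sub (x ∷ p) (y ∷ z) (v ∷ w) = trans (cong (_+_ (x * (y - v))) (·-sub p z w))
  (solve 5 (λ x y v a b → x :* (y :- v) :+ (a :- b) := x :* y :+ a :- (x :* v :+ b))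
         refl x y v (p · z) (p · w))

square-≡ : ∀ m → m ℕ.^ 2 ≡ m ℕ.* m
square-≡ m = cong (m ℕ.*_) (ℕₚ.*-identityʳ m)

square-cancel-≤ : ∀ {m o} → m ℕ.^ 2 ≤ o ℕ.^ 2 → m ≤ o
square-cancel-≤ {m} {o} m²≤o² with m ℕₚ.≤? o
... | yes m≤o = m≤o
... | no  m≰o = contradiction
  (subst₂ _<_ (sym (square-≡ o)) (sym (square-≡ m)) (ℕₚ.*-mono-< (ℕₚ.≰⇒> m≰o) (ℕₚ.≰⇒> m≰o)))
  (ℕₚ.≤⇒≯ m²≤o²)

square-+ : ∀ m o → m ℕ.^ 2 ℕ.+ o ℕ.^ 2 ≤ (m ℕ.+ o) ℕ.^ 2
square-+ m o = subst₂ _≤_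
  (sym (cong₂ ℕ._+_ (square-≡ m) (square-≡ o)))
  (trans (sym (ℕₚ.*-distribʳ-+ (m ℕ.+ o) m o)) (sym (square-≡ (m ℕ.+ o))))
  (ℕₚ.+-mono-≤ (ℕₚ.*-monoʳ-≤ m (ℕₚ.m≤m+n m o)) (ℕₚ.*-monoʳ-≤ o (ℕₚ.m≤n+m o m)))

distSq-translate : (z w : ℤ^ n) → distSq z (Vec.zipWith _-_ z w) ≤ reach w ℕ.^ 2
distSq-translate []      []      = z≤n
distSq-translate (x ∷ z) (y ∷ w) = ℕₚ.≤-trans
  (subst (λ i → ∣ i ∣ ℕ.^ 2 ℕ.+ distSq z (Vec.zipWith _-_ z w) ≤ ∣ y ∣ ℕ.^ 2 ℕ.+ reach w ℕ.^ 2)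
         (solve 2 (λ x y → y := x :- (x :- y)) refl x y)
         (ℕₚ.+-monoʳ-≤ (∣ y ∣ ℕ.^ 2) (distSq-translate z w)))
  (square-+ ∣ y ∣ (reach w))

-- Each coordinate of the difference of `z` and `w` is at most `C` in absolute value.
·-lipschitz : ∀ {C} (p z w : ℤ^ n) → distSq z w ≤ C ℕ.^ 2 →
              ∣ p · z - p · w ∣ ≤ reach p ℕ.* C
·-lipschitz         []      []      []      _ = z≤n
·-lipschitz {C = C} (x ∷ p) (y ∷ z) (v ∷ w) d≤ = begin
  ∣ x * y + p · z - (x * v + p · w) ∣
    ≡⟨ cong ∣_∣ (solve 5 (λ x y v a b → x :* y :+ a :- (x :* v :+ b) := x :* (y :- v) :+ (a :- b))
                       refl x y v (p · z) (p · w)) ⟩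
  ∣ x * (y - v) + (p · z - p · w) ∣
    ≤⟨ ℤₚ.∣i+j∣≤∣i∣+∣j∣ (x * (y - v)) (p · z - p · w) ⟩
  ∣ x * (y - v) ∣ ℕ.+ ∣ p · z - p · w ∣
    ≡⟨ cong (ℕ._+ ∣ p · z - p · w ∣) (ℤₚ.abs-* x (y - v)) ⟩
  ∣ x ∣ ℕ.* ∣ y - v ∣ ℕ.+ ∣ p · z - p · w ∣
    ≤⟨ ℕₚ.+-mono-≤
         (ℕₚ.*-monoʳ-≤ ∣ x ∣ (square-cancel-≤ (ℕₚ.≤-trans (ℕₚ.m≤m+n _ (distSq z w)) d≤)))
         (·-lipschitz p z w (ℕₚ.≤-trans (ℕₚ.m≤n+m (distSq z w) _) d≤)) ⟩
  ∣ x ∣ ℕ.* C ℕ.+ reach p ℕ.* C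
    ≡⟨ ℕₚ.*-distribʳ-+ C ∣ x ∣ (reach p) ⟨
  (∣ x ∣ ℕ.+ reach p) ℕ.* C ∎
  where open ℕₚ.≤-Reasoning

B⇒∣p·z∣≤ : ∀ {C} (p : ℤ^ n) {z} → B C (D (Ψ p)) z → ∣ p · z ∣ ≤ reach p ℕ.* C ℕ.+ reach p
B⇒∣p·z∣≤ {C = C} p {z} (s , s∈D , z-s≤C) = begin
  ∣ p · z ∣
    ≡⟨ cong ∣_∣ (solve 2 (λ a b → a := a :- b :+ b) refl (p · z) (p · s)) ⟩
  ∣ p · z - p · s + p · s ∣
    ≤⟨ ℤₚ.∣i+j∣≤∣i∣+∣j∣ (p · z - p · s) (p · s) ⟩
  ∣ p · z - p · s ∣ ℕ.+ ∣ p · s ∣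
    ≤⟨ ℕₚ.+-mono-≤ (·-lipschitz p z s z-s≤C)
         (Lψ≢0⇒∣t∣≤reach p {p · s} (λ Lψ≡0 → s∈D (trans (Δ-pullback p s ψ) Lψ≡0))) ⟩
  reach p ℕ.* C ℕ.+ reach p ∎
  where open ℕₚ.≤-Reasoning

-- Minima up to double negation

¬¬-minimum : {A : Set} (f : A → ℤ) (b : ℤ) → (∀ a → b ℤ.≤ f a) → A →
             DoubleNegation (∃[ a ] (∀ a′ → f a ℤ.≤ f a′))
¬¬-minimum {A} f b b≤f a₀ no-minimum =
  let m , eq = i≤j⇒j≡i+n (b≤f a₀) in search m a₀ (ℤₚ.≤-reflexive eq)
  where
  -- Were there no minimum, each value could be undercut, which lowers the bound `m` on its height
  -- above `b`.
  search : ∀ m a → f a ℤ.≤ b + + m → _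
  search m a f≤ = no-minimum (a , λ a′ → go m f≤ a′ (f a ℤₚ.≤? f a′))
    where
    go : ∀ m → f a ℤ.≤ b + + m → ∀ a′ → _ → f a ℤ.≤ f a′
    go _       f≤ a′ (yes fa≤) = fa≤
    go zero    f≤ a′ (no  _  ) =
      ℤₚ.≤-trans f≤ (ℤₚ.≤-trans (ℤₚ.≤-reflexive (ℤₚ.+-identityʳ b)) (b≤f a′))
    go (suc m) f≤ a′ (no  fa≰) = contradiction
      (≤-by-difference (ℤₚ.≤-trans (i<j⇒i+1≤j (ℤₚ.≰⇒> fa≰)) f≤)
        (solve 3 (λ x b m → b :+ m :- x := b :+ (con 1ℤ :+ m) :- (x :+ con 1ℤ))
               refl (f a′) b (+ m)))
      (search m a′)

-- Constructively, double negation passes through finite conjunctions but not through quantification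
-- over all integers; hence the ball.
¬¬-ball : {P : ℤ → Set} → (∀ t → DoubleNegation (P t)) →
          ∀ r → DoubleNegation (∀ t → ∣ t ∣ ≤ r → P t)
¬¬-ball {P} ¬¬P zero    ¬all = ¬¬P 0ℤ λ P0 → ¬all λ t t≤0 →
  subst P (sym (ℤₚ.∣i∣≡0⇒i≡0 (ℕₚ.n≤0⇒n≡0 t≤0))) P0
¬¬-ball {P} ¬¬P (suc r) ¬all =
  ¬¬-ball ¬¬P r λ inside → ¬¬P (+ suc r) λ P+ → ¬¬P -[1+ r ] λ P- →
    ¬all λ t t≤ → extend inside P+ P- (∣i∣≤1+n⇒ t t≤)
  where
  extend : ∀ {t} → (∀ t → ∣ t ∣ ≤ r → P t) → P (+ suc r) → P -[1+ r ] →
           ∣ t ∣ ≤ r ⊎ t ≡ + suc r ⊎ t ≡ -[1+ r ] → P t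
  extend inside P+ P- (inj₁ t≤)          = inside _ t≤
  extend inside P+ P- (inj₂ (inj₁ refl)) = P+
  extend inside P+ P- (inj₂ (inj₂ refl)) = P-

-- The huskings of `Ψ p`

module Husking {n : ℕ} (p u : ℤ^ n) (p·u≡1 : p · u ≡ 1ℤ) where
  open Profiles p u p·u≡1
  open Rigidity p u p·u≡1

  lift : ℤ → ℤ^ n
  lift t = Vec.map (t *_) u

  p·lift : ∀ t → p · lift t ≡ t
  p·lift t = trans (·-scale p u t) (trans (cong (t *_) p·u≡1) (ℤₚ.*-identityʳ t))

  -- `ψ` is maximal at 0 and strictly smaller after a negative step. Hence the hyperplane
  -- `p · z ≡ 0ℤ` belongs to the deviation set.
  Lψ0≢0 : L p ψ 0ℤ ≢ 0ℤ
  Lψ0≢0 Lψ≡0 = contradiction (begin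
    + suc a
      ≤⟨ neighbour-bound {ψ} {0ℤ} (λ {τ} _ → ℤₚ.i⊓j≤i 0ℤ (0ℤ + τ))
                         (-step∈steps p (proj₂ unit)) ⟩
    + degree * 0ℤ - L p ψ 0ℤ
      ≡⟨ cong₂ _-_ (ℤₚ.*-zeroʳ (+ degree)) Lψ≡0 ⟩
    0ℤ ∎) λ { (ℤ.+≤+ ()) }
    where
    open ℤₚ.≤-Reasoning
    a : ℕ
    a = proj₁ unit

  -- Subtracting `p · z` times `u` moves `z` to a point `s` of the hyperplane `p · s ≡ 0ℤ`, at a
  -- distance controlled by `reach u`.
  tube : ∀ {r z} → ∣ p · z ∣ ≤ r → B (suc (r ℕ.* reach u)) (D (Ψ p)) z
  tube {r} {z} z≤r = s , s∈D , (begin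
    distSq z s                     ≤⟨ distSq-translate z w ⟩
    reach w ℕ.^ 2                  ≡⟨ cong (ℕ._^ 2) (reach-scale u (p · z)) ⟩
    (∣ p · z ∣ ℕ.* reach u) ℕ.^ 2  ≤⟨ ℕₚ.^-monoˡ-≤ 2 (ℕₚ.≤-trans (ℕₚ.*-monoˡ-≤ (reach u) z≤r)
                                                                 (ℕₚ.n≤1+n _)) ⟩
    suc (r ℕ.* reach u) ℕ.^ 2      ∎)
    where
    open ℕₚ.≤-Reasoning
    w s : ℤ^ n
    w = lift (p · z)
    s = Vec.zipWith _-_ z w

    p·s≡0 : p · s ≡ 0ℤ
    p·s≡0 = trans (·-sub p z w)
      (trans (cong (_-_ (p · z)) (p·lift (p · z))) (ℤₚ.+-inverseʳ (p · z)))

    s∈D : D (Ψ p) s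
    s∈D ΔΨ≡0 = Lψ0≢0 (trans (cong (L p ψ) (sym p·s≡0))
                            (trans (sym (Δ-pullback p s ψ)) ΔΨ≡0))

  pullback-near : ∀ {h} → Profile p h →
                  ｛ Ψ p ≢ (λ z → h (p · z)) ｝ ⊆ B (suc (supportRadius ℕ.* reach u)) (D (Ψ p))
  pullback-near {h} π {z} Ψ≢h with supportRadius ℕₚ.≤? ∣ p · z ∣
  ... | yes R≤ = contradiction (sym (uniform-support π (p · z) R≤)) Ψ≢h
  ... | no  R≰ = tube {z = z} (ℕₚ.<⇒≤ (ℕₚ.≰⇒> R≰))

  admissible⇒Θ : ∀ {k h} → Admissible p k h → Θ k (Ψ p) (λ z → h (p · z))
  admissible⇒Θ {k} {h} α = record
    { superharmonic = λ z → subst (ℤ._≤ 0ℤ) (sym (Δ-pullback p z h)) (α.superharmonic (p · z))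
    ; lower         = λ z → α.lower (p · z)
    ; upper         = λ z → α.upper (p · z)
    ; near          = suc (supportRadius ℕ.* reach u) , s≤s z≤n , pullback-near α.profile
    }
    where module α = Admissible α

  -- Minimising over the fibres of z ↦ p · z replaces an arbitrary competitor by
  -- an admissible function of p · z. The minima exist only classically.
  fibre-minimum : ∀ {k G} → Θ k (Ψ p) G →
    DoubleNegation (∃[ g ] Admissible p k g × (∀ z → g (p · z) ℤ.≤ G z))
  fibre-minimum {k} {G} θ none =
    ¬¬-ball {FibreMinimum}
      (λ t → ¬¬-minimum (G ∘ proj₁) (ψ t - + k) (bounded t) (lift t , p·lift t))
      r λ choice → none (conclude choice)
    where
    open Θ θ
    Fibre : ℤ → Set
    Fibre t = ∃[ z ] p · z ≡ t

    FibreMinimum : ℤ → Set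
    FibreMinimum t = Σ[ a ∈ Fibre t ] (∀ (a′ : Fibre t) → G (proj₁ a) ℤ.≤ G (proj₁ a′))

    bounded : ∀ t (a : Fibre t) → ψ t - + k ℤ.≤ G (proj₁ a)
    bounded _ (z , refl) = lower z

    -- Where `∣ p · z ∣` exceeds this, `B⇒∣p·z∣≤` shows that `G` equals `Ψ p`, so it is constant on
    -- the fibre and `lift t` is a minimiser.
    r : ℕ
    r = reach p ℕ.* proj₁ near ℕ.+ reach p

    far : ∀ z → ¬ (∣ p · z ∣ ≤ r) → G z ≡ ψ (p · z)
    far z z≰r with G z ℤₚ.≟ ψ (p · z)
    ... | yes eq = eq
    ... | no  ≢  = contradiction (B⇒∣p·z∣≤ p {z} (proj₂ (proj₂ near) {z} (≢ ∘ sym))) z≰r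

    module _ (choice : ∀ t → ∣ t ∣ ≤ r → FibreMinimum t) where

      attained : ∀ t → FibreMinimum t
      attained t with ∣ t ∣ ℕₚ.≤? r
      ... | yes t≤r = choice t t≤r
      ... | no  t≰r = (lift t , p·lift t) , λ (z , p·z≡t) → ℤₚ.≤-reflexive (trans
        (far′ (p·lift t)) (sym (far′ p·z≡t)))
        where
        far′ : ∀ {z} → p · z ≡ t → G z ≡ ψ t
        far′ {z} refl = far z t≰r

      g : ℤ → ℤ
      g t = G (proj₁ (proj₁ (attained t)))

      g≤ : ∀ z → g (p · z) ℤ.≤ G z
      g≤ z = proj₂ (attained (p · z)) (z , refl)

      conclude : ∃[ g ] Admissible p k g × (∀ z → g (p · z) ℤ.≤ G z)
      conclude = g , record
        { profile = record
          { superharmonic = L≤0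
          ; upper         = transfer (λ t v → v ℤ.≤ ψ t) upper
          ; radius        = r
          ; outside       = transfer (λ t v → r < ∣ t ∣ → v ≡ ψ t) (λ z r<z → far z (ℕₚ.<⇒≱ r<z))
          }
        ; lower = transfer (λ t v → ψ t - + k ℤ.≤ v) lower
        } , g≤
        where
        transfer : (Q : ℤ → ℤ → Set) → (∀ z → Q (p · z) (G z)) → ∀ t → Q t (g t)
        transfer Q q t =
          let (z , p·z≡t) , _ = attained t in subst (λ s → Q s (g t)) p·z≡t (q z)

        L≤0 : ∀ t → L p g t ℤ.≤ 0ℤ
        L≤0 t =
          let (z , p·z≡t) , _ = attained t
          in subst (λ s → L p g s ℤ.≤ 0ℤ) p·z≡t
               (ℤₚ.≤-trans (L≤Δ p z g G (cong g p·z≡t) g≤) (superharmonic z))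

  least : ∀ k → ∃[ h ] Admissible p k h × (∀ {g} → Admissible p k g → ∀ t → h t ℤ.≤ g t)
  least k = Enumeration.least p supportRadius k uniform-support

  husk : ℕ → ℤ → ℤ
  husk k = proj₁ (least k)

  husk-admissible : ∀ k → Admissible p k (husk k)
  husk-admissible k = proj₁ (proj₂ (least k))

  husk-least : ∀ k {g} → Admissible p k g → ∀ t → husk k t ℤ.≤ g t
  husk-least k = proj₂ (proj₂ (least k))

  -- Minimality is a decidable inequality of integers, so the double negation in `fibre-minimum` can
  -- be removed.
  husk-isHusking : ∀ k → IsHusking k (Ψ p) (λ z → husk k (p · z))
  husk-isHusking k z =
    (_ , admissible⇒Θ (husk-admissible k) , refl) ,
    λ { (G , θ , refl) → decidable-stable (husk k (p · z) ℤₚ.≤? G z) λ ≰ →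
          fibre-minimum θ λ (g , α , g≤G) →
            ≰ (ℤₚ.≤-trans (husk-least k α (p · z)) (g≤G z)) }

  -- By `uniform-depth` every profile obeys the lower bound for `suc depth`, so raising `k` further
  -- brings no new competitors.
  husk-stable : ∀ k → suc depth < k → ∀ t → husk k t ≡ husk (suc depth) t
  husk-stable k N<k t = ℤₚ.≤-antisym
    (husk-least k (deepen (husk-admissible (suc depth))
      (λ t → ℤₚ.≤-trans (ℤₚ.+-monoʳ-≤ (ψ t) (ℤₚ.neg-mono-≤ (ℤ.+≤+ (ℕₚ.<⇒≤ N<k))))
                        (Admissible.lower (husk-admissible (suc depth)) t))) t)
    (husk-least (suc depth) (deepen (husk-admissible k)
      (λ t → ℤₚ.≤-trans (ℤₚ.+-monoʳ-≤ (ψ t) (ℤₚ.neg-mono-≤ (ℤ.+≤+ (ℕₚ.n≤1+n depth))))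
                        (uniform-depth (Admissible.profile (husk-admissible k)) t))) t)
    where
    deepen : ∀ {j j′ h} → Admissible p j h → (∀ t → ψ t - + j′ ℤ.≤ h t) → Admissible p j′ h
    deepen α lower = record { profile = Admissible.profile α ; lower = lower }

theorem2 : (n : ℕ) → 1 ≤ n → (p : ℤ^ n) → Primitive p →
    Σ[ husk ∈ (ℕ → ℤ^ n → ℤ) ] (∀ k → IsHusking k (Ψ p) (husk k)) ×
    (∃[ N ] 0 < N ×
    (∀ k → N < k → ∀ z → husk k z ≡ husk N z) ×
    (∃[ C ] 0 < C × ｛ husk N ≢ Ψ p ｝ ⊆ B C (D (Ψ p))))
theorem2 n _ p p-primitive =
  (λ k z → husk k (p · z)) , husk-isHusking ,
  -- The successor makes `0 < N` immediate.
  suc depth , s≤s z≤n ,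
  (λ k N<k z → husk-stable k N<k (p · z)) ,
  suc (Rigidity.supportRadius p u p·u≡1 ℕ.* reach u) , s≤s z≤n ,
  λ {z} h≢Ψ → pullback-near (Admissible.profile (husk-admissible (suc depth))) {z} (h≢Ψ ∘ sym)
  where
  dual = primitive⇒dual p-primitive
  u     = proj₁ dual
  p·u≡1 = proj₂ dual
  open Husking p u p·u≡1
  open Rigidity p u p·u≡1 using (depth)
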